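{- For all integers $n\ge 0$ and $k \geq 1$ put $T_n=\tau(n+1)$ and $S_k=-24\,\sigma(k)$. Then for every integer $n\ge 1$: (i) $n!\,T_n=|J_n(\overline{S})|$; (ii) $S_n=(-1)^{n-1}|H_n(\overline{T})|$; (iii) $-24\,\sigma(n)=(-1)^{n-1}|H_n(\overline{T})|$; (iv) $T_n=\sum_{|\lambda|=n} z_\lambda^{ -1}S_\lambda$, the sum running over all partitions $\lambda$ of $n$.
   Context: $\tau$ is Ramanujan's tau function, defined by $\sum_{n\ge1}\tau(n)q^n=q\prod_{m\ge1}(1-q^m)^{24}$, and $\sigma(n)=\sum_{d\mid n}d$. $|M|$ denotes the determinant of a square matrix $M$. For a sequence $\overline{j}=(j_1,j_2,\dots)$, $J_n(\overline{j})$ is the $n\times n$ matrix whose $(i,k)$ entry is $j_{i-k+1}$ for $1\le k\le i\le n$, is $-i$ for $k=i+1$, and is $0$ for $k>i+1$. For a sequence $\overline{h}=(h_0,h_1,h_2,\dots)$ with $h_0=1$, $H_n(\overline{h})$ is the $n\times n$ matrix whose first column has entries $i\,h_i$ ($1\le i\le n$), whose $(i,k)$ entry is $h_{i-k+1}$ for $2\le k\le i$, is $1$ for $k=i+1$, and is $0$ for $k>i+1$. A partition $\lambda$ is a non-increasing sequence $(\lambda_1,\lambda_2,\dots)$ of non-negative integers with finitely many non-zero terms; $|\lambda|=\sum_i\lambda_i$; $m_k(\lambda)$ is the number of parts of $\lambda$ equal to $k$; $z_\lambda=\prod_{k\ge1}k^{m_k(\lambda)}m_k(\lambda)!$; and $S_\lambda=\prod_i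 S_{\lambda_i}$, the product being over the positive parts of $\lambda$. -}

module Defs where

open import Data.Bool.Base using (if_then_else_)
open import Data.Empty using (⊥-elim)
open import Data.Fin.Base using (Fin; zero; suc; toℕ; punchIn)
open import Data.Fin.Properties using (toℕ<n)
open import Data.Integer.Base as ℤ using (ℤ; 0ℤ; 1ℤ; -1ℤ)
import Data.Integer.Properties as ℤ
open import Data.List.Base
  using (List; []; _∷_; _++_; map; concatMap; filter; foldr; length; replicate; upTo; applyUpTo)
open import Data.List.Properties using (++-cancelˡ; ∷-injectiveʳ)
open import Data.List.Membership.Propositional using (_∈_)
open import Data.List.Membership.Propositional.Properties
  using (∈-map⁺; ∈-map⁻; ∈-concat⁺′; ∈-concat⁻′; ∈-upTo⁺; ∈-upTo⁻)
open import Data.List.Relation.Unary.All as All using (All; []; _∷_)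
import Data.List.Relation.Unary.All.Properties as All
open import Data.List.Relation.Unary.AllPairs as AllPairs using (AllPairs; []; _∷_)
import Data.List.Relation.Unary.AllPairs.Properties as AllPairs
open import Data.List.Relation.Unary.Any using (here)
open import Data.List.Relation.Unary.Linked using (Linked)
open import Data.List.Relation.Unary.Linked.Properties using (AllPairs⇒Linked; Linked⇒AllPairs)
open import Data.List.Relation.Unary.Unique.Propositional using (Unique)
import Data.List.Relation.Unary.Unique.Propositional.Properties as Unique
open import Data.Nat.Base
open import Data.Nat.Divisibility using (_∣?_)
open import Data.Nat.DivMod using (m*n/n≡m; m/n*n≤m; /-monoˡ-≤)
open import Data.Nat.ListAction using (sum; product)
open import Data.Nat.ListAction.Properties using (sum-++; product≢0)
open import Data.Nat.Properties
open import Data.Product.Base using (∃; _×_; _,_; proj₁; proj₂)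
open import Data.Rational.Base as ℚ using (ℚ; 0ℚ)
open import Function.Base using (flip)
open import Function.Bundles using (_⇔_; mk⇔)
open import Relation.Binary.PropositionalEquality
  using (_≡_; _≢_; refl; sym; trans; cong; cong₂; subst; module ≡-Reasoning)
open import Relation.Nullary.Decidable using (yes; no; dec-false)
open import Relation.Nullary.Negation.Core using (¬_)

open import Algebra.Properties.CommutativeMonoid.Sum ℤ.+-0-commutativeMonoid public
  using () renaming (sum to sumℤ)
open import Algebra.Properties.CommutativeMonoid.Sum ℤ.+-0-commutativeMonoid
  using (sum-cong-≗; sum-replicate-zero)

Matrix : ℕ → Set
Matrix n = Fin n → Fin n → ℤ

-- Laplace expansion along the first row; `punchIn k` skips column k.
det : ∀ {n} → Matrix n → ℤ
det {zero}  A = 1ℤ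
det {suc n} A =
  sumℤ λ k → -1ℤ ℤ.^ toℕ k ℤ.* A zero k ℤ.* det (λ i j → A (suc i) (punchIn k j))

-- `Fin` indices are zero-based; `fromEntries a` has entry `a i k` in row i and
-- column k, counted from 1.
fromEntries : (ℕ → ℕ → ℤ) → ∀ n → Matrix n
fromEntries a n i k = a (suc (toℕ i)) (suc (toℕ k))

-- The value `j 0` is never used.
J : ∀ n → (ℕ → ℤ) → Matrix n
J n j = fromEntries entry n
  where
  entry : ℕ → ℕ → ℤ
  entry i k =
    if k ≤ᵇ i     then j (i ∸ k + 1) else
    if k ≡ᵇ i + 1 then ℤ.- (ℤ.+ i)   else
                       0ℤ

-- The value `h 0` is never used: the superdiagonal is the constant 1, in
-- accordance with the normalisation h 0 = 1 (for T, see `T-0`).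
H : ∀ n → (ℕ → ℤ) → Matrix n
H n h = fromEntries entry n
  where
  entry : ℕ → ℕ → ℤ
  entry i k =
    if k ≡ᵇ 1     then ℤ.+ i ℤ.* h i else
    if k ≤ᵇ i     then h (i ∸ k + 1) else
    if k ≡ᵇ i + 1 then 1ℤ            else
                       0ℤ

-- Formal power series over ℤ; `f n` is the coefficient of qⁿ.
Series : Set
Series = ℕ → ℤ

infixl 7 _⊛_
infixl 6 _⊖_
infixr 8 _⊛^_

_⊖_ : Series → Series → Series
(f ⊖ g) n = f n ℤ.- g n

_⊛_ : Series → Series → Series
(f ⊛ g) n = sumℤ {suc n} λ i → f (toℕ i) ℤ.* g (n ∸ toℕ i)

q^ : ℕ → Series
q^ m n = if n ≡ᵇ m then 1ℤ else 0ℤ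

𝟙 : Series
𝟙 = q^ 0

_⊛^_ : Series → ℕ → Series
f ⊛^ zero  = 𝟙
f ⊛^ suc e = f ⊛ (f ⊛^ e)

∏≤ : ℕ → (ℕ → Series) → Series
∏≤ zero    F = 𝟙
∏≤ (suc N) F = F (suc N) ⊛ ∏≤ N F

-- ∏_{m≥1} F m for factors with F m ≡ 1 (mod q^m): the coefficient of qⁿ in the
-- partial products is then constant from N = n on, see
-- `∏≤-stable` and `eulerFactor-≡1`.
∏≥1 : (ℕ → Series) → Series
∏≥1 F n = ∏≤ n F n

eulerFactor : ℕ → Series
eulerFactor m = (𝟙 ⊖ q^ m) ⊛^ 24

τ : ℕ → ℤ
τ = q^ 1 ⊛ ∏≥1 eulerFactor

σ : ℕ → ℕ
σ n = sum (filter (_∣? n) (applyUpTo suc n))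

T : ℕ → ℤ
T n = τ (n + 1)

T-0 : T 0 ≡ 1ℤ
T-0 = refl

-- Only the values at positive arguments are meaningful.
S : ℕ → ℤ
S k = ℤ.- (ℤ.+ 24) ℤ.* ℤ.+ σ k

-- A partition is encoded by the list of its positive parts; trailing zeros are
-- dropped.
IsPartition : ℕ → List ℕ → Set
IsPartition n ps = Linked _≥_ ps × All (_> 0) ps × sum ps ≡ n

-- Partitions of n with all parts at most k, grouped by the multiplicity of k.
partitions≤ : ℕ → ℕ → List (List ℕ)
partitions≤ zero    zero    = [] ∷ []
partitions≤ zero    (suc n) = []
partitions≤ (suc k) n       = concatMap
  (λ m → map (replicate m (suc k) ++_) (partitions≤ k (n ∸ m * suc k)))
  (upTo (suc (n / suc k)))

-- Each partition of n exactly once: see `∈-partitions` and `partitions-unique`.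
partitions : ℕ → List (List ℕ)
partitions n = partitions≤ n n

mult : ℕ → List ℕ → ℕ
mult k ps = length (filter (_≟ k) ps)

-- The factors with k > |ps| are 1.
z : List ℕ → ℕ
z ps = product (map (λ k → k ^ mult k ps * mult k ps !) (applyUpTo suc (sum ps)))

z≢0 : ∀ ps → NonZero (z ps)
z≢0 ps = product≢0 (All.map⁺ (All.applyUpTo⁺₂ suc (sum ps) λ i →
  m*n≢0 (suc i ^ mult (suc i) ps) (mult (suc i) ps !)
    {{m^n≢0 (suc i) (mult (suc i) ps)}} {{mult (suc i) ps !≢0}}))

z⁻¹ : List ℕ → ℚ
z⁻¹ ps = (1ℤ ℚ./ z ps) {{z≢0 ps}}

-- The product of s over the parts, written S_λ in the case of S.
_at_ : (ℕ → ℤ) → List ℕ → ℤ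
s at ps = foldr ℤ._*_ 1ℤ (map s ps)

sumOverPartitions : ℕ → (List ℕ → ℚ) → ℚ
sumOverPartitions n f = foldr ℚ._+_ 0ℚ (map f (partitions n))

_≡1below_ : Series → ℕ → Set
g ≡1below m = ∀ k → k < m → g k ≡ 𝟙 k

private
  ⊛-≡1 : ∀ {f m} → f ≡1below m → ∀ g n → n < m → (f ⊛ g) n ≡ g n
  ⊛-≡1 {f} {m} f≡1 g n n<m = begin
    f 0 ℤ.* g n ℤ.+ sumℤ {n} (λ i → f (suc (toℕ i)) ℤ.* g (n ∸ suc (toℕ i)))
      ≡⟨ cong₂ ℤ._+_ (cong (ℤ._* g n) (f≡1 0 (≤-trans (s≤s z≤n) n<m)))
           (sum-cong-≗ {n} λ i → cong (ℤ._* g (n ∸ suc (toℕ i)))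
             (f≡1 (suc (toℕ i)) (≤-trans (s≤s (toℕ<n i)) n<m))) ⟩
    1ℤ ℤ.* g n ℤ.+ sumℤ {n} (λ i → 0ℤ)
      ≡⟨ cong₂ ℤ._+_ (ℤ.*-identityˡ (g n)) (sum-replicate-zero n) ⟩
    g n ℤ.+ 0ℤ
      ≡⟨ ℤ.+-identityʳ (g n) ⟩
    g n ∎
    where open ≡-Reasoning

  base-≡1 : ∀ m → (𝟙 ⊖ q^ m) ≡1below m
  base-≡1 m k k<m = trans
    (cong (λ b → 𝟙 k ℤ.- (if b then 1ℤ else 0ℤ)) (dec-false (k ≟ m) (<⇒≢ k<m)))
    (ℤ.+-identityʳ (𝟙 k))

  ⊛^-≡1 : ∀ {f m} → f ≡1below m → ∀ e → (f ⊛^ e) ≡1below m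
  ⊛^-≡1         f≡1 zero    k k<m = refl
  ⊛^-≡1 {f} {m} f≡1 (suc e) k k<m =
    trans (⊛-≡1 {f} {m} f≡1 (f ⊛^ e) k k<m) (⊛^-≡1 {f} {m} f≡1 e k k<m)

∏≤-stable : ∀ {F} → (∀ m → F m ≡1below m) → ∀ n d → ∏≤ (d + n) F n ≡ ∏≥1 F n
∏≤-stable     F≡1 n zero    = refl
∏≤-stable {F} F≡1 n (suc d) = trans
  (⊛-≡1 {F m} {m} (F≡1 m) (∏≤ (d + n) F) n (s≤s (m≤n+m n d)))
  (∏≤-stable F≡1 n d)
  where
  m = suc (d + n)

eulerFactor-≡1 : ∀ m → eulerFactor m ≡1below m
eulerFactor-≡1 m = ⊛^-≡1 {𝟙 ⊖ q^ m} {m} (base-≡1 m) 24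

private
  Bounded : ℕ → ℕ → List ℕ → Set
  Bounded k n ps = AllPairs _≥_ ps × All (_> 0) ps × All (_≤ k) ps × sum ps ≡ n

  sum-rep : ∀ m a ps → sum (replicate m a ++ ps) ≡ m * a + sum ps
  sum-rep zero    a ps = refl
  sum-rep (suc m) a ps = trans (cong (a +_) (sum-rep m a ps)) (sym (+-assoc a (m * a) (sum ps)))

  sorted-rep : ∀ m {a ps} → All (_≤ a) ps → AllPairs _≥_ ps → AllPairs _≥_ (replicate m a ++ ps)
  sorted-rep zero    _  s = s
  sorted-rep (suc m) ub s =
    All.++⁺ (All.replicate⁺ m ≤-refl) ub ∷ sorted-rep m ub s

  sound : ∀ k n {ps} → ps ∈ partitions≤ k n → Bounded k n ps
  sound zero    zero (here refl) = [] , [] , [] , refl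
  sound (suc k) n p∈
    with xs , p∈xs , xs∈ ← ∈-concat⁻′ (map _ (upTo (suc (n / suc k)))) p∈
    with m , m∈ , refl ← ∈-map⁻ _ xs∈
    with ps , ps∈ , refl ← ∈-map⁻ _ p∈xs
    with s , pos , ub , eq ← sound k (n ∸ m * suc k) ps∈
    = sorted-rep m ub′ s
    , All.++⁺ (All.replicate⁺ m (s≤s z≤n)) pos
    , All.++⁺ (All.replicate⁺ m ≤-refl) ub′
    , trans (sum-rep m (suc k) ps) (trans (cong (m * suc k +_) eq) (m+[n∸m]≡n m*k≤n))
    where
    ub′ = All.map m≤n⇒m≤1+n ub
    m*k≤n : m * suc k ≤ n
    m*k≤n = ≤-trans (*-monoˡ-≤ (suc k) (s≤s⁻¹ (∈-upTo⁻ m∈))) (m/n*n≤m n (suc k))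

  split : ∀ k ps → AllPairs _≥_ ps → All (_> 0) ps → All (_≤ suc k) ps →
          ∃ λ m → ∃ λ qs → ps ≡ replicate m (suc k) ++ qs ×
            AllPairs _≥_ qs × All (_> 0) qs × All (_≤ k) qs
  split k [] s pos ub = 0 , [] , refl , [] , [] , []
  split k (p ∷ ps) (ge ∷ s) (p>0 ∷ pos) (p≤ ∷ ub) with p ≟ suc k
  ... | yes refl with m , qs , refl , rest ← split k ps s pos ub = suc m , qs , refl , rest
  ... | no  p≢   = 0 , p ∷ ps , refl , ge ∷ s , p>0 ∷ pos , p≤k ∷ All.map (λ x≤p → ≤-trans x≤p p≤k) ge
    where
    p≤k = s≤s⁻¹ (≤∧≢⇒< p≤ p≢)

  complete : ∀ k n {ps} → Bounded k n ps → ps ∈ partitions≤ k n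
  complete zero _ {[]}     (_ , _ , _ , refl) = here refl
  complete zero _ {p ∷ ps} (_ , p>0 ∷ _ , p≤0 ∷ _ , _) = ⊥-elim (<⇒≱ p>0 p≤0)
  complete (suc k) n {ps} (s , pos , ub , refl)
    with m , qs , refl , s′ , pos′ , ub′ ← split k ps s pos ub
    = ∈-concat⁺′ (∈-map⁺ (replicate m (suc k) ++_) qs∈) (∈-map⁺ _ (∈-upTo⁺ (s≤s m≤)))
    where
    N  = sum (replicate m (suc k) ++ qs)
    eq : N ≡ m * suc k + sum qs
    eq = sum-rep m (suc k) qs
    m≤ : m ≤ N / suc k
    m≤ = subst (_≤ N / suc k) (m*n/n≡m m (suc k))
           (/-monoˡ-≤ (suc k) (subst (m * suc k ≤_) (sym eq) (m≤m+n (m * suc k) (sum qs))))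
    qs∈ : qs ∈ partitions≤ k (N ∸ m * suc k)
    qs∈ = complete k (N ∸ m * suc k)
      (s′ , pos′ , ub′ , sym (trans (cong (_∸ m * suc k) eq) (m+n∸m≡n (m * suc k) (sum qs))))

  rep-inj : ∀ {k} m m′ {ps qs} → All (_≤ k) ps → All (_≤ k) qs →
            replicate m (suc k) ++ ps ≡ replicate m′ (suc k) ++ qs → m ≡ m′
  rep-inj zero    zero     _          _          _    = refl
  rep-inj zero    (suc m′) (k<k ∷ _)  _          refl = ⊥-elim (n≮n _ k<k)
  rep-inj (suc m) zero     _          (k<k ∷ _)  refl = ⊥-elim (n≮n _ k<k)
  rep-inj (suc m) (suc m′) ub         ub′        eq   = cong suc (rep-inj m m′ ub ub′ (∷-injectiveʳ eq))

  unique : ∀ k n → Unique (partitions≤ k n)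
  unique zero    zero    = [] ∷ []
  unique zero    (suc n) = []
  unique (suc k) n = Unique.concat⁺
    (All.map⁺ (All.universal
      (λ m → Unique.map⁺ (++-cancelˡ (replicate m (suc k)) _ _) (unique k (n ∸ m * suc k))) _))
    (AllPairs.map⁺ (AllPairs.map disjoint (Unique.upTo⁺ (suc (n / suc k)))))
    where
    block : ℕ → List (List ℕ)
    block m = map (replicate m (suc k) ++_) (partitions≤ k (n ∸ m * suc k))
    disjoint : ∀ {m m′} → m ≢ m′ → ∀ {ps} → ¬ (ps ∈ block m × ps ∈ block m′)
    disjoint {m} {m′} m≢m′ (p∈ , p∈′)
      with ps , ps∈ , refl ← ∈-map⁻ _ p∈
      with qs , qs∈ , eq ← ∈-map⁻ _ p∈′
      = m≢m′ (rep-inj m m′ (bound m ps∈) (bound m′ qs∈) eq)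
      where
      bound : ∀ m {ps} → ps ∈ partitions≤ k (n ∸ m * suc k) → All (_≤ k) ps
      bound m p∈ = proj₁ (proj₂ (proj₂ (sound k (n ∸ m * suc k) p∈)))

  parts≤sum : ∀ ps → All (_≤ sum ps) ps
  parts≤sum []       = []
  parts≤sum (p ∷ ps) =
    m≤m+n p (sum ps) ∷ All.map (λ x≤ → ≤-trans x≤ (m≤n+m (sum ps) p)) (parts≤sum ps)

∈-partitions : ∀ {n ps} → ps ∈ partitions n ⇔ IsPartition n ps
∈-partitions {n} {ps} = mk⇔
  (λ p∈ → let s , pos , _ , eq = sound n n p∈ in AllPairs⇒Linked s , pos , eq)
  λ where
    (s , pos , refl) →
      complete n n (Linked⇒AllPairs (flip ≤-trans) s , pos , parts≤sum ps , refl)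

partitions-unique : ∀ n → Unique (partitions n)
partitions-unique n = unique n n

{-# OPTIONS --safe #-}
-- Let θ = q d/dq. From θ (1 − qᵐ) = − m (qᵐ + q²ᵐ + …) (1 − qᵐ), a product of such
-- factors raised to the 24th power satisfies θ P = (Σ S_k q^k) P, that is
-- n T_n = Σ_{k=1}^n S_k T_{n−k}.
-- * Since T_0 = 1, this recurrence exhibits a combination of the columns of J_n (or
--   of H_n) in which the first column has coefficient 1 and which vanishes except
--   for its last entry; the determinant can then be read off.
-- * Grouped by multiplicities, the partition sum over parts at most N is the
--   coefficient of qⁿ in ∏_{k≤N} exp (S_k q^k / k), which up to q^N satisfies the
--   same recurrence.
module Submission where

open import Defs
open import Algebra.Bundles using (CommutativeRing; CommutativeSemiring)
open import Data.Bool.Base using (if_then_else_; true; false)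
open import Data.Fin.Base using (Fin; zero; suc; toℕ; punchIn)
open import Data.Integer.Base as ℤ using (ℤ; 0ℤ; 1ℤ)
import Data.Integer.Properties as ℤ
open import Data.List.Base
  using (List; []; _∷_; [_]; _++_; map; concatMap; filter; foldr; length; replicate; upTo; applyUpTo)
open import Data.List.Properties
  using (applyUpTo-∷ʳ; map-++; map-upTo; map-∘; filter-++; filter-accept; filter-reject; filter-none)
open import Data.List.Relation.Unary.All as All using (All; []; _∷_)
import Data.List.Relation.Unary.All.Properties as All
open import Data.Nat.Base as ℕ
  using (ℕ; zero; suc; _≤_; _<_; _∸_; _<ᵇ_; _≡ᵇ_; z≤n; s≤s; _!; NonZero)
open import Data.Nat.Divisibility using (_∣?_; divides; ∣m+n∣m⇒∣n; ∣m∣n⇒∣m+n; ∣-refl; ∣⇒≤; _∣0)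
import Data.Nat.DivMod as ℕ
open import Data.Nat.Induction using (Acc; acc; <-wellFounded)
open import Data.Nat.ListAction using (sum; product)
open import Data.Nat.ListAction.Properties using (sum-++; product-++)
import Data.Nat.Properties as ℕ
open import Data.Product.Base using (_,_)
open import Data.Sum.Base using (inj₁; inj₂)
open import Function.Base using (_∘_)
open import Function.Bundles using (mk⇔)
open import Level using (Level)
open import Relation.Binary.PropositionalEquality as ≡ using (_≢_)
open import Relation.Nullary.Decidable using (does; yes; no; dec-true; dec-false; does-⇔)

-- Logarithmic derivatives are handled without division, logarithms or exponentials: an equation
-- `θ f ≐ a ∗ f` stands for θ f / f = a, and `θ-log` makes such `a` additive over products. Both the
-- Euler product and the partition sums are reached through finite products of factors whose `a` is
-- known. Infinite products need no theory, since a coefficient of degree n involves only degrees up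
-- to n, and further factors leave it unchanged. The semiring is a parameter because τ and the
-- determinants live in ℤ while the weights 1 / z_λ live in ℚ; over ℤ, `∗` is `⊛` by computation.
-- The determinants require no division: the recurrence, with its factor n, is itself the linear
-- relation between the columns, with coefficients T_1, T_2, ... for J and -S_1, -S_2, ... for H.
-- Only the partition formula cancels n, and does so in ℚ.

module FormalSeries {c ℓ : Level} (R : CommutativeSemiring c ℓ) where

  open CommutativeSemiring R
  open import Algebra.Properties.CommutativeMonoid.Mult +-commutativeMonoid using (×-distrib-+)
  open import Algebra.Properties.CommutativeMonoid.Sum +-commutativeMonoid using () renaming (sum to sumᶠ)
  open import Algebra.Properties.CommutativeSemigroup +-commutativeSemigroup using (interchange; x∙yz≈y∙xz)
  open import Algebra.Properties.Semiring.Mult semiring using (_×_; ×-comm-*)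
  open import Relation.Binary.Reasoning.Setoid setoid

  -- Cauchy products and the derivation θ

  infixl 7 _∗_
  infixl 6 _⊞_
  infix  4 _≐_

  _≐_ : (f g : ℕ → Carrier) → Set ℓ
  f ≐ g = ∀ n → f n ≈ g n

  -- `(f ∗ g) (suc n)` computes to `f 0 * g (suc n) + (tail f ∗ g) n`; the inductions on the degree
  -- below rest on this unfolding.
  _⊞_ _∗_ : (f g : ℕ → Carrier) → ℕ → Carrier
  (f ⊞ g) n = f n + g n
  (f ∗ g) n = sumᶠ {suc n} λ i → f (toℕ i) * g (n ∸ toℕ i)

  tail θ : (ℕ → Carrier) → ℕ → Carrier
  tail f n = f (suc n)
  θ f n = n × f n

  mono : ℕ → Carrier → ℕ → Carrier
  mono a s n = if n ≡ᵇ a then s else 0#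

  -- The bound on the degrees is what allows truncated sums and products to stand in for infinite
  -- ones.
  ∗-cong-≤ : ∀ {f f′ g g′} n → (∀ i → i ≤ n → f i ≈ f′ i) → (∀ i → i ≤ n → g i ≈ g′ i) →
             (f ∗ g) n ≈ (f′ ∗ g′) n
  ∗-cong-≤ zero    f≈ g≈ = +-congʳ (*-cong (f≈ 0 z≤n) (g≈ 0 z≤n))
  ∗-cong-≤ (suc n) f≈ g≈ = +-cong
    (*-cong (f≈ 0 z≤n) (g≈ (suc n) ℕ.≤-refl))
    (∗-cong-≤ n (λ i i≤n → f≈ (suc i) (s≤s i≤n)) (λ i i≤n → g≈ i (ℕ.m≤n⇒m≤1+n i≤n)))

  ∗-cong : ∀ {f f′ g g′} → f ≐ f′ → g ≐ g′ → f ∗ g ≐ f′ ∗ g′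
  ∗-cong f≐ g≐ n = ∗-cong-≤ n (λ i _ → f≐ i) (λ i _ → g≐ i)

  ∗-zeroˡ : ∀ {f} → f ≐ (λ _ → 0#) → ∀ g n → (f ∗ g) n ≈ 0#
  ∗-zeroˡ f≐ g zero    = trans (+-identityʳ _) (trans (*-congʳ (f≐ 0)) (zeroˡ _))
  ∗-zeroˡ f≐ g (suc n) = trans
    (+-cong (trans (*-congʳ (f≐ 0)) (zeroˡ _)) (∗-zeroˡ (λ i → f≐ (suc i)) g n))
    (+-identityˡ 0#)

  ∗-distribʳ : ∀ h f g → (f ⊞ g) ∗ h ≐ f ∗ h ⊞ g ∗ h
  ∗-distribʳ h f g zero = begin
    (f 0 + g 0) * h 0 + 0#                  ≈⟨ +-identityʳ _ ⟩
    (f 0 + g 0) * h 0                       ≈⟨ distribʳ _ _ _ ⟩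
    f 0 * h 0 + g 0 * h 0                   ≈⟨ +-cong (+-identityʳ _) (+-identityʳ _) ⟨
    (f 0 * h 0 + 0#) + (g 0 * h 0 + 0#)     ∎
  ∗-distribʳ h f g (suc n) = begin
    (f 0 + g 0) * h (suc n) + ((tail f ⊞ tail g) ∗ h) n
      ≈⟨ +-cong (distribʳ _ _ _) (∗-distribʳ h (tail f) (tail g) n) ⟩
    (f 0 * h (suc n) + g 0 * h (suc n)) + ((tail f ∗ h) n + (tail g ∗ h) n)
      ≈⟨ interchange _ _ _ _ ⟩
    (f ∗ h) (suc n) + (g ∗ h) (suc n) ∎

  ∗-scaleˡ : ∀ c f g n → ((λ i → c * f i) ∗ g) n ≈ c * (f ∗ g) n
  ∗-scaleˡ c f g zero = begin
    c * f 0 * g 0 + 0#   ≈⟨ +-identityʳ _ ⟩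
    c * f 0 * g 0        ≈⟨ *-assoc _ _ _ ⟩
    c * (f 0 * g 0)      ≈⟨ *-congˡ (+-identityʳ _) ⟨
    c * (f 0 * g 0 + 0#) ∎
  ∗-scaleˡ c f g (suc n) =
    trans (+-cong (*-assoc _ _ _) (∗-scaleˡ c (tail f) g n)) (sym (distribˡ _ _ _))

  -- Splits off the last summand instead of the first, so that the shift falls on the second factor;
  -- commutativity follows by comparing the two splittings.
  ∗-snoc : ∀ f g n → (f ∗ g) (suc n) ≈ f (suc n) * g 0 + (f ∗ tail g) n
  ∗-snoc f g zero = begin
    f 0 * g 1 + (f 1 * g 0 + 0#)  ≈⟨ x∙yz≈y∙xz _ _ _ ⟩
    f 1 * g 0 + (f 0 * g 1 + 0#)  ∎
  ∗-snoc f g (suc n) = begin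
    f 0 * g (suc (suc n)) + (tail f ∗ g) (suc n)
      ≈⟨ +-congˡ (∗-snoc (tail f) g n) ⟩
    f 0 * g (suc (suc n)) + (f (suc (suc n)) * g 0 + (tail f ∗ tail g) n)
      ≈⟨ x∙yz≈y∙xz _ _ _ ⟩
    f (suc (suc n)) * g 0 + (f ∗ tail g) (suc n) ∎

  ∗-comm : ∀ f g → f ∗ g ≐ g ∗ f
  ∗-comm f g zero    = +-congʳ (*-comm _ _)
  ∗-comm f g (suc n) = begin
    f 0 * g (suc n) + (tail f ∗ g) n  ≈⟨ +-cong (*-comm _ _) (∗-comm (tail f) g n) ⟩
    g (suc n) * f 0 + (g ∗ tail f) n  ≈⟨ ∗-snoc g f n ⟨
    (g ∗ f) (suc n)                   ∎

  ∗-assoc : ∀ f g h → (f ∗ g) ∗ h ≐ f ∗ (g ∗ h)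
  ∗-assoc f g h zero = +-congʳ (begin
    (f 0 * g 0 + 0#) * h 0  ≈⟨ *-congʳ (+-identityʳ _) ⟩
    f 0 * g 0 * h 0         ≈⟨ *-assoc _ _ _ ⟩
    f 0 * (g 0 * h 0)       ≈⟨ *-congˡ (+-identityʳ _) ⟨
    f 0 * (g 0 * h 0 + 0#)  ∎)
  ∗-assoc f g h (suc n) = begin
    (f 0 * g 0 + 0#) * h (suc n) + (((λ i → f 0 * tail g i) ⊞ (tail f ∗ g)) ∗ h) n
      ≈⟨ +-cong (trans (*-congʳ (+-identityʳ _)) (*-assoc _ _ _))
           (trans (∗-distribʳ h (λ i → f 0 * tail g i) (tail f ∗ g) n)
             (+-cong (∗-scaleˡ (f 0) (tail g) h n) (∗-assoc (tail f) g h n))) ⟩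
    f 0 * (g 0 * h (suc n)) + (f 0 * (tail g ∗ h) n + (tail f ∗ (g ∗ h)) n)
      ≈⟨ +-assoc _ _ _ ⟨
    f 0 * (g 0 * h (suc n)) + f 0 * (tail g ∗ h) n + (tail f ∗ (g ∗ h)) n
      ≈⟨ +-congʳ (distribˡ _ _ _) ⟨
    (f ∗ (g ∗ h)) (suc n) ∎

  -- Leibniz rule, by induction on the degree. Passing from n to n + 1 leaves one extra
  -- `(tail f ∗ g) n`, which is absorbed because `tail (θ f)` computes to `tail f ⊞ θ (tail f)`.
  θ-∗ : ∀ f g → θ (f ∗ g) ≐ θ f ∗ g ⊞ f ∗ θ g
  θ-∗ f g zero = sym (begin
    (0# * g 0 + 0#) + (f 0 * 0# + 0#)
      ≈⟨ +-cong (+-identityʳ _) (+-identityʳ _) ⟩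
    0# * g 0 + f 0 * 0#
      ≈⟨ +-cong (zeroˡ _) (zeroʳ _) ⟩
    0# + 0#
      ≈⟨ +-identityˡ 0# ⟩
    0# ∎)
  θ-∗ f g (suc n) = begin
    suc n × (f 0 * g (suc n) + (tail f ∗ g) n)
      ≈⟨ ×-distrib-+ _ _ (suc n) ⟩
    suc n × (f 0 * g (suc n)) + ((tail f ∗ g) n + θ (tail f ∗ g) n)
      ≈⟨ +-cong (sym (×-comm-* (suc n) _ _)) (+-congˡ (θ-∗ (tail f) g n)) ⟩
    f 0 * θ g (suc n) + ((tail f ∗ g) n + ((θ (tail f) ∗ g) n + (tail f ∗ θ g) n))
      ≈⟨ +-congˡ (+-assoc _ _ _) ⟨
    f 0 * θ g (suc n) + ((tail f ∗ g) n + (θ (tail f) ∗ g) n + (tail f ∗ θ g) n)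
      ≈⟨ x∙yz≈y∙xz _ _ _ ⟩
    (tail f ∗ g) n + (θ (tail f) ∗ g) n + (f ∗ θ g) (suc n)
      ≈⟨ +-congʳ (trans (+-congʳ (zeroˡ _)) (trans (+-identityˡ _) (∗-distribʳ g (tail f) (θ (tail f)) n))) ⟨
    (θ f ∗ g) (suc n) + (f ∗ θ g) (suc n) ∎

  -- θ (f g) / (f g) = θ f / f + θ g / g, with the denominators cleared.
  θ-log : ∀ {a b f g} → θ f ≐ a ∗ f → θ g ≐ b ∗ g → θ (f ∗ g) ≐ (a ⊞ b) ∗ (f ∗ g)
  θ-log {a} {b} {f} {g} θf θg n = begin
    θ (f ∗ g) n
      ≈⟨ θ-∗ f g n ⟩
    (θ f ∗ g) n + (f ∗ θ g) n
      ≈⟨ +-cong (∗-cong {g = g} θf (λ _ → refl) n) (∗-cong {f = f} (λ _ → refl) θg n) ⟩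
    (a ∗ f ∗ g) n + (f ∗ (b ∗ g)) n
      ≈⟨ +-cong (∗-assoc a f g n) (swap n) ⟩
    (a ∗ (f ∗ g)) n + (b ∗ (f ∗ g)) n
      ≈⟨ ∗-distribʳ (f ∗ g) a b n ⟨
    ((a ⊞ b) ∗ (f ∗ g)) n ∎
    where
    swap : f ∗ (b ∗ g) ≐ b ∗ (f ∗ g)
    swap n = begin
      (f ∗ (b ∗ g)) n  ≈⟨ ∗-assoc f b g n ⟨
      (f ∗ b ∗ g) n    ≈⟨ ∗-cong {g = g} (∗-comm f b) (λ _ → refl) n ⟩
      (b ∗ f ∗ g) n    ≈⟨ ∗-assoc b f g n ⟩
      (b ∗ (f ∗ g)) n  ∎

  -- Indices run from 1 to N as in `∏≤`: this is the logarithmic derivative of a product of N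
  -- factors with logarithmic derivatives `D 1`, ..., `D N`.
  ∑≤ : ℕ → (ℕ → ℕ → Carrier) → ℕ → Carrier
  ∑≤ zero    D n = 0#
  ∑≤ (suc N) D n = D (suc N) n + ∑≤ N D n

  mono-∗-< : ∀ {a n} → n < a → ∀ s f → (mono a s ∗ f) n ≈ 0#
  mono-∗-< {suc a} {zero}  _           s f = trans (+-identityʳ _) (zeroˡ _)
  mono-∗-< {suc a} {suc n} (s≤s n<a) s f =
    trans (+-congʳ (zeroˡ _)) (trans (+-identityˡ _) (mono-∗-< n<a s f))

  mono-∗-+ : ∀ a s f n → (mono a s ∗ f) (a ℕ.+ n) ≈ s * f n
  mono-∗-+ zero    s f zero    = +-identityʳ _
  mono-∗-+ zero    s f (suc n) =
    trans (+-congˡ (∗-zeroˡ (λ _ → refl) f n)) (+-identityʳ _)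
  mono-∗-+ (suc a) s f n       =
    trans (+-congʳ (zeroˡ _)) (trans (+-identityˡ _) (mono-∗-+ a s f n))

  mono-≢ : ∀ {a n} → n ≢ a → ∀ s → mono a s n ≈ 0#
  mono-≢ {a} {n} n≢a s = reflexive (≡.cong (if_then s else 0#) (dec-false (n ℕ.≟ a) n≢a))

  mono-refl : ∀ a s → mono a s a ≈ s
  mono-refl zero    s = refl
  mono-refl (suc a) s = mono-refl a s

-- The partition sum as a coefficient of a product of exponentials

module PartitionSum where

  open import Data.Integer.Base using (+_)
  open import Data.Rational.Base as ℚ using (ℚ; 0ℚ; 1ℚ; _+_; _*_; _/_; toℚᵘ; fromℚᵘ)
  import Data.Rational.Properties as ℚ
  open import Data.Rational.Solver using (module +-*-Solver)
  import Data.Rational.Unnormalised.Base as ℚᵘ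
  import Data.Rational.Unnormalised.Properties as ℚᵘ
  open import Algebra.Properties.Monoid.Mult ℚ.+-0-monoid using (_×_; ×-congʳ)
  open import Relation.Binary.PropositionalEquality
    using (_≡_; refl; sym; trans; cong; cong₂; module ≡-Reasoning)
  open FormalSeries (CommutativeRing.commutativeSemiring ℚ.+-*-commutativeRing)

  fromℚᵘ-+ : ∀ p q → fromℚᵘ (p ℚᵘ.+ q) ≡ fromℚᵘ p + fromℚᵘ q
  fromℚᵘ-+ p q = ℚ.toℚᵘ-injective (begin
    toℚᵘ (fromℚᵘ (p ℚᵘ.+ q))                 ≈⟨ ℚ.toℚᵘ-fromℚᵘ (p ℚᵘ.+ q) ⟩
    p ℚᵘ.+ q                                 ≈⟨ ℚᵘ.+-cong (ℚ.toℚᵘ-fromℚᵘ p) (ℚ.toℚᵘ-fromℚᵘ q) ⟨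
    toℚᵘ (fromℚᵘ p) ℚᵘ.+ toℚᵘ (fromℚᵘ q)     ≈⟨ ℚ.toℚᵘ-homo-+ (fromℚᵘ p) (fromℚᵘ q) ⟨
    toℚᵘ (fromℚᵘ p + fromℚᵘ q)               ∎)
    where open ℚᵘ.≃-Reasoning

  fromℚᵘ-* : ∀ p q → fromℚᵘ (p ℚᵘ.* q) ≡ fromℚᵘ p * fromℚᵘ q
  fromℚᵘ-* p q = ℚ.toℚᵘ-injective (begin
    toℚᵘ (fromℚᵘ (p ℚᵘ.* q))                 ≈⟨ ℚ.toℚᵘ-fromℚᵘ (p ℚᵘ.* q) ⟩
    p ℚᵘ.* q                                 ≈⟨ ℚᵘ.*-cong (ℚ.toℚᵘ-fromℚᵘ p) (ℚ.toℚᵘ-fromℚᵘ q) ⟨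
    toℚᵘ (fromℚᵘ p) ℚᵘ.* toℚᵘ (fromℚᵘ q)     ≈⟨ ℚ.toℚᵘ-homo-* (fromℚᵘ p) (fromℚᵘ q) ⟨
    toℚᵘ (fromℚᵘ p * fromℚᵘ q)               ∎)
    where open ℚᵘ.≃-Reasoning

  /1-+ : ∀ i j → (i ℤ.+ j) / 1 ≡ i / 1 + j / 1
  /1-+ i j = trans
    (cong₂ (λ x y → (x ℤ.+ y) / 1) (sym (ℤ.*-identityʳ i)) (sym (ℤ.*-identityʳ j)))
    (fromℚᵘ-+ (ℚᵘ.mkℚᵘ i 0) (ℚᵘ.mkℚᵘ j 0))

  /1-* : ∀ i j → (i ℤ.* j) / 1 ≡ i / 1 * (j / 1)
  /1-* i j = fromℚᵘ-* (ℚᵘ.mkℚᵘ i 0) (ℚᵘ.mkℚᵘ j 0)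

  -- The denominator is a variable `k` with an equation, since `z qs` is a product only up to a
  -- proof; matching on `refl` replaces rewriting under the `NonZero` instance.
  1/-* : ∀ {k} m n .{{_ : NonZero k}} .{{_ : NonZero m}} .{{_ : NonZero n}} →
         k ≡ m ℕ.* n → 1ℤ / k ≡ 1ℤ / m * (1ℤ / n)
  1/-* (suc m) (suc n) refl = fromℚᵘ-* (ℚᵘ.mkℚᵘ 1ℤ m) (ℚᵘ.mkℚᵘ 1ℤ n)

  1/n*n≡1 : ∀ n .{{_ : NonZero n}} → 1ℤ / n * (+ n / 1) ≡ 1ℚ
  1/n*n≡1 (suc n) = trans (sym (fromℚᵘ-* (ℚᵘ.mkℚᵘ 1ℤ n) (ℚᵘ.mkℚᵘ (+ suc n) 0)))
    (ℚ.fromℚᵘ-cong {ℚᵘ.mkℚᵘ 1ℤ n ℚᵘ.* ℚᵘ.mkℚᵘ (+ suc n) 0} {ℚᵘ.1ℚᵘ}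
      (ℚᵘ.*-inverseˡ (ℚᵘ.mkℚᵘ (+ suc n) 0)))

  /1-cancelˡ : ∀ n .{{_ : NonZero n}} x y → + n / 1 * x ≡ + n / 1 * y → x ≡ y
  /1-cancelˡ n x y eq = trans (sym (undo x)) (trans (cong (1ℤ / n *_) eq) (undo y))
    where
    undo : ∀ x → 1ℤ / n * (+ n / 1 * x) ≡ x
    undo x = trans (sym (ℚ.*-assoc (1ℤ / n) (+ n / 1) x))
      (trans (cong (_* x) (1/n*n≡1 n)) (ℚ.*-identityˡ x))

  ×-ℚ : ∀ n x → n × x ≡ + n / 1 * x
  ×-ℚ zero    x = sym (ℚ.*-zeroˡ x)
  ×-ℚ (suc n) x = begin
    x + n × x                   ≡⟨ cong₂ _+_ (sym (ℚ.*-identityˡ x)) (×-ℚ n x) ⟩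
    1ℚ * x + + n / 1 * x        ≡⟨ ℚ.*-distribʳ-+ x 1ℚ (+ n / 1) ⟨
    (1ℚ + + n / 1) * x          ≡⟨ cong (_* x) (/1-+ 1ℤ (+ n)) ⟨
    + suc n / 1 * x             ∎
    where open ≡-Reasoning

  ×-zero : ∀ n → n × 0ℚ ≡ 0ℚ
  ×-zero n = trans (×-ℚ n 0ℚ) (ℚ.*-zeroʳ (+ n / 1))

  /1-⊛ : ∀ f g n → (f ⊛ g) n / 1 ≡ ((λ i → f i / 1) ∗ (λ i → g i / 1)) n
  /1-⊛ f g zero    = trans (/1-+ (f 0 ℤ.* g 0) 0ℤ) (cong (_+ 0ℚ) (/1-* (f 0) (g 0)))
  /1-⊛ f g (suc n) = trans (/1-+ (f 0 ℤ.* g (suc n)) ((f ∘ suc ⊛ g) n))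
    (cong₂ _+_ (/1-* (f 0) (g (suc n))) (/1-⊛ (f ∘ suc) g n))

  ∑ : ∀ {A : Set} → (A → ℚ) → List A → ℚ
  ∑ f xs = foldr _+_ 0ℚ (map f xs)

  module _ {A : Set} where

    ∑-cong : ∀ {f g : A → ℚ} {xs} → All (λ x → f x ≡ g x) xs → ∑ f xs ≡ ∑ g xs
    ∑-cong []         = refl
    ∑-cong (eq ∷ eqs) = cong₂ _+_ eq (∑-cong eqs)

    ∑-++ : ∀ (f : A → ℚ) xs ys → ∑ f (xs ++ ys) ≡ ∑ f xs + ∑ f ys
    ∑-++ f []       ys = sym (ℚ.+-identityˡ _)
    ∑-++ f (x ∷ xs) ys = trans (cong (_+_ (f x)) (∑-++ f xs ys)) (sym (ℚ.+-assoc (f x) _ _))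

    ∑-*ˡ : ∀ c (f : A → ℚ) xs → ∑ (λ x → c * f x) xs ≡ c * ∑ f xs
    ∑-*ˡ c f []       = sym (ℚ.*-zeroʳ c)
    ∑-*ˡ c f (x ∷ xs) = trans (cong (_+_ (c * f x)) (∑-*ˡ c f xs)) (sym (ℚ.*-distribˡ-+ c (f x) _))

    ∑-map : ∀ {B : Set} (f : A → ℚ) (g : B → A) xs → ∑ f (map g xs) ≡ ∑ (f ∘ g) xs
    ∑-map f g xs = cong (foldr _+_ 0ℚ) (sym (map-∘ xs))

    ∑-concatMap : ∀ {B : Set} (f : A → ℚ) (g : B → List A) xs →
                  ∑ f (concatMap g xs) ≡ ∑ (λ x → ∑ f (g x)) xs
    ∑-concatMap f g []       = refl
    ∑-concatMap f g (x ∷ xs) =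
      trans (∑-++ f (g x) (concatMap g xs)) (cong (_+_ (∑ f (g x))) (∑-concatMap f g xs))

  -- The series Σ E m q^(a m).
  substPower : (a : ℕ) .{{_ : NonZero a}} → (ℕ → ℚ) → ℕ → ℚ
  substPower a E n = if does (a ∣? n) then E (n ℕ./ a) else 0ℚ

  module _ {a : ℕ} .{{_ : NonZero a}} where

    open ≡-Reasoning

    substPower-< : ∀ E {n} → n < a → substPower a E n ≡ mono 0 (E 0) n
    substPower-< E {zero}  _   = trans
      (cong (λ b → if b then E (0 ℕ./ a) else 0ℚ) (dec-true (a ∣? 0) (a ∣0)))
      (cong E (ℕ.0/n≡0 a))
    substPower-< E {suc n} n<a =
      cong (λ b → if b then E (suc n ℕ./ a) else 0ℚ)
        (dec-false (a ∣? suc n) λ a∣ → ℕ.<⇒≱ n<a (∣⇒≤ a∣))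

    [a+d]/a : ∀ d → (a ℕ.+ d) ℕ./ a ≡ suc (d ℕ./ a)
    [a+d]/a d = trans (ℕ.+-distrib-/-∣ˡ d ∣-refl) (cong (ℕ._+ d ℕ./ a) (ℕ.n/n≡1 a))

    substPower-+ : ∀ E d → substPower a E (a ℕ.+ d) ≡ substPower a (tail E) d
    substPower-+ E d = cong₂ (λ b m → if b then E m else 0ℚ)
      (does-⇔ (mk⇔ (λ a∣ → ∣m+n∣m⇒∣n a∣ ∣-refl) (∣m∣n⇒∣m+n ∣-refl)) (a ∣? (a ℕ.+ d)) (a ∣? d))
      ([a+d]/a d)

    -- Horner's scheme in q^a: the only multiple of a below a is 0, and the others are reached by a
    -- shift. It lets a recursion pass to `tail E` while the degree drops by a.
    substPower-unfold : ∀ E → substPower a E ≐ mono 0 (E 0) ⊞ mono a 1ℚ ∗ substPower a (tail E)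
    substPower-unfold E n with n ℕ.<? a
    ... | yes n<a = begin
      substPower a E n          ≡⟨ substPower-< E n<a ⟩
      mono 0 (E 0) n            ≡⟨ ℚ.+-identityʳ _ ⟨
      mono 0 (E 0) n + 0ℚ       ≡⟨ cong (_+_ (mono 0 (E 0) n)) (mono-∗-< n<a 1ℚ (substPower a (tail E))) ⟨
      mono 0 (E 0) n + (mono a 1ℚ ∗ substPower a (tail E)) n ∎
    ... | no  n≮a with d , refl ← ℕ.m≤n⇒∃[o]m+o≡n (ℕ.≮⇒≥ n≮a) = begin
      substPower a E n                ≡⟨ substPower-+ E d ⟩
      substPower a (tail E) d         ≡⟨ ℚ.*-identityˡ _ ⟨
      1ℚ * substPower a (tail E) d    ≡⟨ mono-∗-+ a 1ℚ (substPower a (tail E)) d ⟨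
      M                               ≡⟨ ℚ.+-identityˡ M ⟨
      0ℚ + M                          ≡⟨ cong (_+ M) (mono-≢ a+d≢0 (E 0)) ⟨
      mono 0 (E 0) n + M              ∎
      where
      M = (mono a 1ℚ ∗ substPower a (tail E)) (a ℕ.+ d)
      a+d≢0 : a ℕ.+ d ≢ 0
      a+d≢0 eq = ℕ.≢-nonZero⁻¹ a (ℕ.m+n≡0⇒m≡0 a eq)

    substPower-∗ : ∀ E f n → (substPower a E ∗ f) n ≡ E 0 * f n + (mono a 1ℚ ∗ (substPower a (tail E) ∗ f)) n
    substPower-∗ E f n = begin
      (substPower a E ∗ f) n
        ≡⟨ ∗-cong {substPower a E} {mono 0 (E 0) ⊞ mono a 1ℚ ∗ G} {f} {f} (substPower-unfold E) (λ _ → refl) n ⟩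
      ((mono 0 (E 0) ⊞ mono a 1ℚ ∗ G) ∗ f) n
        ≡⟨ ∗-distribʳ f (mono 0 (E 0)) (mono a 1ℚ ∗ G) n ⟩
      (mono 0 (E 0) ∗ f) n + (mono a 1ℚ ∗ G ∗ f) n
        ≡⟨ cong₂ _+_ (mono-∗-+ 0 (E 0) f n) (∗-assoc (mono a 1ℚ) G f n) ⟩
      E 0 * f n + (mono a 1ℚ ∗ (G ∗ f)) n ∎
      where G = substPower a (tail E)

    -- In degree n the product sees only the exponents m a ≤ n, that is m ≤ n / a. The degree drops
    -- by a in each round, hence the accessibility argument; `E` is general because the recursive
    -- call is made for `tail E`.
    ∑-substPower : ∀ f n → Acc _<_ n → ∀ E →
      ∑ (λ m → E m * f (n ∸ m ℕ.* a)) (upTo (suc (n ℕ./ a))) ≡ (substPower a E ∗ f) n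
    ∑-substPower f n (acc rs) E = begin
      E 0 * f n + ∑ F (applyUpTo suc (n ℕ./ a))
        ≡⟨ cong (λ xs → E 0 * f n + ∑ F xs) (map-upTo suc (n ℕ./ a)) ⟨
      E 0 * f n + ∑ F (map suc (upTo (n ℕ./ a)))
        ≡⟨ cong (_+_ (E 0 * f n)) (∑-map F suc (upTo (n ℕ./ a))) ⟩
      E 0 * f n + ∑ (F ∘ suc) (upTo (n ℕ./ a))
        ≡⟨ cong (_+_ (E 0 * f n)) rest ⟩
      E 0 * f n + (mono a 1ℚ ∗ (substPower a (tail E) ∗ f)) n
        ≡⟨ substPower-∗ E f n ⟨
      (substPower a E ∗ f) n ∎
      where
      F : ℕ → ℚ
      F m = E m * f (n ∸ m ℕ.* a)
      rest : ∑ (F ∘ suc) (upTo (n ℕ./ a)) ≡ (mono a 1ℚ ∗ (substPower a (tail E) ∗ f)) n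
      rest with n ℕ.<? a
      ... | yes n<a = trans
        (cong (λ q → ∑ (F ∘ suc) (upTo q)) (ℕ.m<n⇒m/n≡0 n<a))
        (sym (mono-∗-< n<a 1ℚ (substPower a (tail E) ∗ f)))
      ... | no  n≮a with d , refl ← ℕ.m≤n⇒∃[o]m+o≡n (ℕ.≮⇒≥ n≮a) = begin
        ∑ (F ∘ suc) (upTo ((a ℕ.+ d) ℕ./ a))
          ≡⟨ cong (λ q → ∑ (F ∘ suc) (upTo q)) ([a+d]/a d) ⟩
        ∑ (F ∘ suc) (upTo (suc (d ℕ./ a)))
          ≡⟨ ∑-cong (All.universal
              (λ m → cong (λ j → E (suc m) * f j) (ℕ.[m+n]∸[m+o]≡n∸o a d (m ℕ.* a)))
              (upTo (suc (d ℕ./ a)))) ⟩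
        ∑ (λ m → tail E m * f (d ∸ m ℕ.* a)) (upTo (suc (d ℕ./ a)))
          ≡⟨ ∑-substPower f d (rs (ℕ.m<n+m d (ℕ.>-nonZero⁻¹ a))) (tail E) ⟩
        (substPower a (tail E) ∗ f) d
          ≡⟨ ℚ.*-identityˡ _ ⟨
        1ℚ * (substPower a (tail E) ∗ f) d
          ≡⟨ mono-∗-+ a 1ℚ (substPower a (tail E) ∗ f) d ⟨
        (mono a 1ℚ ∗ (substPower a (tail E) ∗ f)) (a ℕ.+ d) ∎

    -- The hypothesis says that Σ E m x^m = exp (s x / a).
    θ-substPower : ∀ {E s} → (∀ m → + (suc m ℕ.* a) / 1 * E (suc m) ≡ s * E m) →
                   θ (substPower a E) ≐ mono a s ∗ substPower a E
    θ-substPower {E} {s} hyp n with n ℕ.<? a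
    ... | yes n<a = begin
      n × substPower a E n          ≡⟨ ×-congʳ n (substPower-< E n<a) ⟩
      n × mono 0 (E 0) n            ≡⟨ low n ⟩
      0ℚ                            ≡⟨ mono-∗-< n<a s (substPower a E) ⟨
      (mono a s ∗ substPower a E) n ∎
      where
      low : ∀ n → n × mono 0 (E 0) n ≡ 0ℚ
      low zero    = refl
      low (suc n) = ×-zero (suc n)
    ... | no  n≮a with d , refl ← ℕ.m≤n⇒∃[o]m+o≡n (ℕ.≮⇒≥ n≮a) = begin
      (a ℕ.+ d) × substPower a E (a ℕ.+ d)     ≡⟨ ×-congʳ (a ℕ.+ d) (substPower-+ E d) ⟩
      (a ℕ.+ d) × substPower a (tail E) d      ≡⟨ high ⟩
      s * substPower a E d                     ≡⟨ mono-∗-+ a s (substPower a E) d ⟨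
      (mono a s ∗ substPower a E) (a ℕ.+ d)    ∎
      where
      -- Both sides vanish unless a divides d; for d = q a the degree a + d is (q + 1) a, and the
      -- claim is the hypothesis at m = q.
      high : (a ℕ.+ d) × substPower a (tail E) d ≡ s * substPower a E d
      high with a ∣? d
      ... | no  _                = trans (×-zero (a ℕ.+ d)) (sym (ℚ.*-zeroʳ s))
      ... | yes (divides q refl) = begin
        (suc q ℕ.* a) × E (suc (q ℕ.* a ℕ./ a))  ≡⟨ cong (λ m → (suc q ℕ.* a) × E (suc m)) (ℕ.m*n/n≡m q a) ⟩
        (suc q ℕ.* a) × E (suc q)                ≡⟨ ×-ℚ (suc q ℕ.* a) (E (suc q)) ⟩
        + (suc q ℕ.* a) / 1 * E (suc q)          ≡⟨ hyp q ⟩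
        s * E q                                  ≡⟨ cong (λ m → s * E m) (ℕ.m*n/n≡m q a) ⟨
        s * E (q ℕ.* a ℕ./ a)                    ∎

  -- Multiplicities and z when copies of a new largest part are added

  mult-replicate-≡ : ∀ m a ps → mult a (replicate m a ++ ps) ≡ m ℕ.+ mult a ps
  mult-replicate-≡ zero    a ps = refl
  mult-replicate-≡ (suc m) a ps = trans
    (cong length (filter-accept (ℕ._≟ a) {xs = replicate m a ++ ps} refl))
    (cong suc (mult-replicate-≡ m a ps))

  mult-replicate-≢ : ∀ {k a} → a ≢ k → ∀ m ps → mult k (replicate m a ++ ps) ≡ mult k ps
  mult-replicate-≢         a≢k zero    ps = refl
  mult-replicate-≢ {k} {a} a≢k (suc m) ps = trans
    (cong length (filter-reject (ℕ._≟ k) {xs = replicate m a ++ ps} a≢k))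
    (mult-replicate-≢ a≢k m ps)

  mult-> : ∀ {N k ps} → N < k → All (_≤ N) ps → mult k ps ≡ 0
  mult-> {k = k} N<k ub = cong length (filter-none (ℕ._≟ k) (All.map (λ p≤N → ℕ.<⇒≢ (ℕ.≤-<-trans p≤N N<k)) ub))

  -- `z` has the cut-off `sum ps`, which changes with the partition. A free cut-off makes partitions
  -- of different sizes comparable factor by factor; `z ps` computes to `z≤ (sum ps) ps`.
  z≤ : ℕ → List ℕ → ℕ
  z≤ N ps = product (map (λ k → k ℕ.^ mult k ps ℕ.* mult k ps !) (applyUpTo suc N))

  z≤-suc : ∀ N ps → z≤ (suc N) ps ≡ z≤ N ps ℕ.* (suc N ℕ.^ mult (suc N) ps ℕ.* mult (suc N) ps !)
  z≤-suc N ps = begin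
    product (map f (applyUpTo suc (suc N)))              ≡⟨ cong (product ∘ map f) (applyUpTo-∷ʳ suc N) ⟨
    product (map f (applyUpTo suc N ++ [ suc N ]))       ≡⟨ cong product (map-++ f (applyUpTo suc N) [ suc N ]) ⟩
    product (map f (applyUpTo suc N) ++ [ f (suc N) ])   ≡⟨ product-++ (map f (applyUpTo suc N)) [ f (suc N) ] ⟩
    z≤ N ps ℕ.* (f (suc N) ℕ.* 1)                        ≡⟨ cong (z≤ N ps ℕ.*_) (ℕ.*-identityʳ (f (suc N))) ⟩
    z≤ N ps ℕ.* f (suc N)                                ∎
    where
    open ≡-Reasoning
    f : ℕ → ℕ
    f k = k ℕ.^ mult k ps ℕ.* mult k ps !

  -- Beyond the largest part every multiplicity is 0, and the factor k^0 0! is 1.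
  z≤-stable : ∀ {N ps} → All (_≤ N) ps → ∀ d → z≤ (d ℕ.+ N) ps ≡ z≤ N ps
  z≤-stable         ub zero    = refl
  z≤-stable {N} {ps} ub (suc d) = begin
    z≤ (suc (d ℕ.+ N)) ps            ≡⟨ z≤-suc (d ℕ.+ N) ps ⟩
    z≤ (d ℕ.+ N) ps ℕ.* f (mult (suc (d ℕ.+ N)) ps)
      ≡⟨ cong (λ m → z≤ (d ℕ.+ N) ps ℕ.* f m) (mult-> (s≤s (ℕ.m≤n+m N d)) ub) ⟩
    z≤ (d ℕ.+ N) ps ℕ.* 1            ≡⟨ ℕ.*-identityʳ _ ⟩
    z≤ (d ℕ.+ N) ps                  ≡⟨ z≤-stable ub d ⟩
    z≤ N ps                          ∎
    where
    open ≡-Reasoning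
    f : ℕ → ℕ
    f m = suc (d ℕ.+ N) ℕ.^ m ℕ.* m !

  parts≤sum : ∀ ps → All (_≤ sum ps) ps
  parts≤sum []       = []
  parts≤sum (p ∷ ps) =
    ℕ.m≤m+n p (sum ps) ∷ All.map (λ x≤ → ℕ.≤-trans x≤ (ℕ.m≤n+m (sum ps) p)) (parts≤sum ps)

  -- Neither of `N` and `sum ps` need exceed the other, so both cut-offs are compared with their
  -- sum.
  z≡z≤ : ∀ {N ps} → All (_≤ N) ps → z ps ≡ z≤ N ps
  z≡z≤ {N} {ps} ub = begin
    z≤ (sum ps) ps             ≡⟨ z≤-stable (parts≤sum ps) N ⟨
    z≤ (N ℕ.+ sum ps) ps       ≡⟨ cong (λ M → z≤ M ps) (ℕ.+-comm N (sum ps)) ⟩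
    z≤ (sum ps ℕ.+ N) ps       ≡⟨ z≤-stable ub (sum ps) ⟩
    z≤ N ps                    ∎
    where open ≡-Reasoning

  z≤-replicate : ∀ {N a} → N < a → ∀ m ps → z≤ N (replicate m a ++ ps) ≡ z≤ N ps
  z≤-replicate {zero}      N<a m ps = refl
  z≤-replicate {suc N} {a} N<a m ps = begin
    z≤ (suc N) (replicate m a ++ ps)
      ≡⟨ z≤-suc N (replicate m a ++ ps) ⟩
    z≤ N (replicate m a ++ ps) ℕ.* f (mult (suc N) (replicate m a ++ ps))
      ≡⟨ cong₂ (λ x i → x ℕ.* f i) (z≤-replicate (ℕ.<⇒≤ N<a) m ps) (mult-replicate-≢ (ℕ.>⇒≢ N<a) m ps) ⟩
    z≤ N ps ℕ.* f (mult (suc N) ps)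
      ≡⟨ z≤-suc N ps ⟨
    z≤ (suc N) ps ∎
    where
    open ≡-Reasoning
    f : ℕ → ℕ
    f i = suc N ℕ.^ i ℕ.* i !

  All-replicate-++ : ∀ {k ps} m → All (_≤ k) ps → All (_≤ suc k) (replicate m (suc k) ++ ps)
  All-replicate-++ m ub = All.++⁺ (All.replicate⁺ m ℕ.≤-refl) (All.map ℕ.m≤n⇒m≤1+n ub)

  -- At cut-off `suc k` the copies of `suc k` enter only the last factor, to which `ps` contributes
  -- nothing because its parts are at most `k`.
  z-replicate : ∀ {k ps} → All (_≤ k) ps → ∀ m →
                z (replicate m (suc k) ++ ps) ≡ (suc k ℕ.^ m ℕ.* m !) ℕ.* z ps
  z-replicate {k} {ps} ub m = begin
    z qs
      ≡⟨ z≡z≤ (All-replicate-++ m ub) ⟩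
    z≤ (suc k) qs
      ≡⟨ z≤-suc k qs ⟩
    z≤ k qs ℕ.* f (mult (suc k) qs)
      ≡⟨ cong₂ (λ x i → x ℕ.* f i) (z≤-replicate {k} ℕ.≤-refl m ps) mult-m ⟩
    z≤ k ps ℕ.* f m
      ≡⟨ cong (ℕ._* f m) (z≡z≤ {k} ub) ⟨
    z ps ℕ.* f m
      ≡⟨ ℕ.*-comm (z ps) (f m) ⟩
    f m ℕ.* z ps ∎
    where
    open ≡-Reasoning
    qs = replicate m (suc k) ++ ps
    f : ℕ → ℕ
    f i = suc k ℕ.^ i ℕ.* i !
    mult-m : mult (suc k) qs ≡ m
    mult-m = trans (mult-replicate-≡ m (suc k) ps)
      (trans (cong (m ℕ.+_) (mult-> ℕ.≤-refl ub)) (ℕ.+-identityʳ m))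

  partitions≤-bounded : ∀ k n → All (All (_≤ k)) (partitions≤ k n)
  partitions≤-bounded zero    zero    = [] ∷ []
  partitions≤-bounded zero    (suc n) = []
  partitions≤-bounded (suc k) n       = All.concat⁺ (All.map⁺ (All.universal
    (λ m → All.map⁺ (All.map (All-replicate-++ m) (partitions≤-bounded k (n ∸ m ℕ.* suc k))))
    (upTo (suc (n ℕ./ suc k)))))

  -- Generating series of the weights s_λ / z_λ

  module _ (s : Series) where

    open ≡-Reasoning

    weight : List ℕ → ℚ
    weight ps = z⁻¹ ps * ((s at ps) / 1)

    -- The coefficients of exp (s a x / a).
    expCoeff : (a : ℕ) .{{_ : NonZero a}} → ℕ → ℚ
    expCoeff a m = (1ℤ / (a ℕ.^ m ℕ.* m !)) {{nz}} * ((s a ℤ.^ m) / 1)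
      where nz = ℕ.m*n≢0 (a ℕ.^ m) (m !) {{ℕ.m^n≢0 a m}} {{m ℕ.!≢0}}

    at-replicate : ∀ m a ps → s at (replicate m a ++ ps) ≡ s a ℤ.^ m ℤ.* (s at ps)
    at-replicate zero    a ps = sym (ℤ.*-identityˡ _)
    at-replicate (suc m) a ps = trans (cong (s a ℤ.*_) (at-replicate m a ps))
      (sym (ℤ.*-assoc (s a) (s a ℤ.^ m) (s at ps)))

    -- This multiplicativity turns the sum over partitions into a product of one series per part
    -- size.
    weight-replicate : ∀ {k ps} → All (_≤ k) ps → ∀ m →
                       weight (replicate m (suc k) ++ ps) ≡ expCoeff (suc k) m * weight ps
    weight-replicate {k} {ps} ub m = begin
      z⁻¹ qs * ((s at qs) / 1)
        ≡⟨ cong₂ _*_ z⁻¹-qs (trans (cong (_/ 1) (at-replicate m (suc k) ps)) (/1-* (s (suc k) ℤ.^ m) (s at ps))) ⟩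
      (x * z⁻¹ ps) * (y * ((s at ps) / 1))
        ≡⟨ interchange x (z⁻¹ ps) y ((s at ps) / 1) ⟩
      (x * y) * weight ps ∎
      where
      open import Algebra.Properties.CommutativeSemigroup (CommutativeRing.*-commutativeSemigroup ℚ.+-*-commutativeRing)
        using (interchange)
      qs = replicate m (suc k) ++ ps
      d  = suc k ℕ.^ m ℕ.* m !
      d≢0 : NonZero d
      d≢0 = ℕ.m*n≢0 (suc k ℕ.^ m) (m !) {{ℕ.m^n≢0 (suc k) m}} {{m ℕ.!≢0}}
      x = (1ℤ / d) {{d≢0}}
      y = (s (suc k) ℤ.^ m) / 1
      z⁻¹-qs : z⁻¹ qs ≡ x * z⁻¹ ps
      z⁻¹-qs = 1/-* {z qs} d (z ps) {{z≢0 qs}} {{d≢0}} {{z≢0 ps}} (z-replicate ub m)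

    -- The differential equation of exp (s_a x / a) in coefficients, in the form `θ-substPower` asks
    -- for. It comes from a^(m+1) (m+1)! = ((m+1) a) (a^m m!).
    expCoeff-suc : ∀ a .{{_ : NonZero a}} m →
                   + (suc m ℕ.* a) / 1 * expCoeff a (suc m) ≡ s a / 1 * expCoeff a m
    expCoeff-suc a m = begin
      X * ((1ℤ / (a ℕ.^ suc m ℕ.* suc m !)) {{nz′}} * ((s a ℤ.* s a ℤ.^ m) / 1))
        ≡⟨ cong₂ (λ u v → X * (u * v)) split (/1-* (s a) (s a ℤ.^ m)) ⟩
      X * ((X⁻¹ * E) * (s a / 1 * ((s a ℤ.^ m) / 1)))
        ≡⟨ reshape X X⁻¹ E (s a / 1) ((s a ℤ.^ m) / 1) ⟩
      (X⁻¹ * X) * (s a / 1 * expCoeff a m)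
        ≡⟨ cong (_* (s a / 1 * expCoeff a m)) (1/n*n≡1 (suc m ℕ.* a) {{nzX}}) ⟩
      1ℚ * (s a / 1 * expCoeff a m)
        ≡⟨ ℚ.*-identityˡ _ ⟩
      s a / 1 * expCoeff a m ∎
      where
      nz : NonZero (a ℕ.^ m ℕ.* m !)
      nz = ℕ.m*n≢0 (a ℕ.^ m) (m !) {{ℕ.m^n≢0 a m}} {{m ℕ.!≢0}}
      nz′ : NonZero (a ℕ.^ suc m ℕ.* suc m !)
      nz′ = ℕ.m*n≢0 (a ℕ.^ suc m) (suc m !) {{ℕ.m^n≢0 a (suc m)}} {{suc m ℕ.!≢0}}
      nzX : NonZero (suc m ℕ.* a)
      nzX = ℕ.m*n≢0 (suc m) a
      X   = + (suc m ℕ.* a) / 1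
      X⁻¹ = (1ℤ / (suc m ℕ.* a)) {{nzX}}
      E   = (1ℤ / (a ℕ.^ m ℕ.* m !)) {{nz}}
      regroup : a ℕ.^ suc m ℕ.* suc m ! ≡ (suc m ℕ.* a) ℕ.* (a ℕ.^ m ℕ.* m !)
      regroup = trans (ℕ-interchange a (a ℕ.^ m) (suc m) (m !))
        (cong (ℕ._* (a ℕ.^ m ℕ.* m !)) (ℕ.*-comm a (suc m)))
        where
        open import Algebra.Properties.CommutativeSemigroup ℕ.*-commutativeSemigroup
          using () renaming (interchange to ℕ-interchange)
      split : (1ℤ / (a ℕ.^ suc m ℕ.* suc m !)) {{nz′}} ≡ X⁻¹ * E
      split = 1/-* {a ℕ.^ suc m ℕ.* suc m !} (suc m ℕ.* a) (a ℕ.^ m ℕ.* m !)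
        {{nz′}} {{nzX}} {{nz}} regroup
      reshape : ∀ x x⁻¹ e u v → x * ((x⁻¹ * e) * (u * v)) ≡ (x⁻¹ * x) * (u * (e * v))
      reshape = solve 5 (λ x x⁻¹ e u v → x :* ((x⁻¹ :* e) :* (u :* v)) := (x⁻¹ :* x) :* (u :* (e :* v))) refl
        where open +-*-Solver

    W : ℕ → ℕ → ℚ
    W k n = ∑ weight (partitions≤ k n)

    factor : ℕ → ℕ → ℚ
    factor k = substPower (suc k) (expCoeff (suc k))

    -- `partitions≤` is already grouped by the multiplicity of its largest admissible part, and the
    -- sum over that multiplicity is a Cauchy product with one exponential.
    W-suc : ∀ k → W (suc k) ≐ factor k ∗ W k
    W-suc k n = begin
      ∑ weight (concatMap block ms)
        ≡⟨ ∑-concatMap weight block ms ⟩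
      ∑ (λ m → ∑ weight (block m)) ms
        ≡⟨ ∑-cong (All.universal ∑-block ms) ⟩
      ∑ (λ m → expCoeff (suc k) m * W k (n ∸ m ℕ.* suc k)) ms
        ≡⟨ ∑-substPower {suc k} (W k) n (<-wellFounded n) (expCoeff (suc k)) ⟩
      (factor k ∗ W k) n ∎
      where
      ms = upTo (suc (n ℕ./ suc k))
      block : ℕ → List (List ℕ)
      block m = map (replicate m (suc k) ++_) (partitions≤ k (n ∸ m ℕ.* suc k))
      ∑-block : ∀ m → ∑ weight (block m) ≡ expCoeff (suc k) m * W k (n ∸ m ℕ.* suc k)
      ∑-block m = begin
        ∑ weight (block m)
          ≡⟨ ∑-map weight (replicate m (suc k) ++_) λs ⟩
        ∑ (λ ps → weight (replicate m (suc k) ++ ps)) λs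
          ≡⟨ ∑-cong (All.map (λ ub → weight-replicate ub m) (partitions≤-bounded k (n ∸ m ℕ.* suc k))) ⟩
        ∑ (λ ps → expCoeff (suc k) m * weight ps) λs
          ≡⟨ ∑-*ˡ (expCoeff (suc k) m) weight λs ⟩
        expCoeff (suc k) m * W k (n ∸ m ℕ.* suc k) ∎
        where λs = partitions≤ k (n ∸ m ℕ.* suc k)

    W-0 : ∀ k → W k 0 ≡ 1ℚ
    W-0 zero    = refl
    -- The constant coefficient of `factor k` computes to 1.
    W-0 (suc k) = trans (W-suc k 0) (cong (λ x → 1ℚ * x + 0ℚ) (W-0 k))

    -- Logarithmic derivative of exp (s_k q^k / k): the single monomial s_k q^k.
    D : ℕ → ℕ → ℚ
    D k = mono k (s k / 1)

    θ-W : ∀ k → θ (W k) ≐ ∑≤ k D ∗ W k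
    θ-W zero n = trans (const n) (sym (∗-zeroˡ (λ _ → refl) (W 0) n))
      where
      const : ∀ n → θ (W 0) n ≡ 0ℚ
      const zero    = refl
      const (suc n) = ×-zero (suc n)
    θ-W (suc k) n = begin
      θ (W (suc k)) n
        ≡⟨ cong (n ×_) (W-suc k n) ⟩
      θ (factor k ∗ W k) n
        ≡⟨ θ-log {D (suc k)} {∑≤ k D} {factor k} {W k} (θ-substPower (expCoeff-suc (suc k))) (θ-W k) n ⟩
      (∑≤ (suc k) D ∗ (factor k ∗ W k)) n
        ≡⟨ ∗-cong {∑≤ (suc k) D} {∑≤ (suc k) D} {W (suc k)} {factor k ∗ W k} (λ _ → refl) (W-suc k) n ⟨
      (∑≤ (suc k) D ∗ W (suc k)) n ∎

    ∑-D-0 : ∀ N → ∑≤ N D 0 ≡ 0ℚ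
    ∑-D-0 zero    = refl
    ∑-D-0 (suc N) = trans (ℚ.+-identityˡ _) (∑-D-0 N)

    ∑-D-> : ∀ {N n} → N < n → ∑≤ N D n ≡ 0ℚ
    ∑-D-> {zero}      N<n = refl
    ∑-D-> {suc N} {n} N<n = trans
      (cong₂ _+_ (mono-≢ (ℕ.>⇒≢ N<n) (s (suc N) / 1)) (∑-D-> (ℕ.<⇒≤ N<n))) (ℚ.+-identityʳ 0ℚ)

    -- Among the monomials of degrees 1 to N exactly one has degree `suc n`: the last one, or one
    -- found by recursion.
    ∑-D : ∀ N n → n < N → ∑≤ N D (suc n) ≡ s (suc n) / 1
    ∑-D (suc N) n n<N with ℕ.m≤n⇒m<n∨m≡n n<N
    ... | inj₁ (s≤s n<N′) = trans
      (cong₂ _+_ (mono-≢ (λ eq → ℕ.<⇒≢ n<N′ (ℕ.suc-injective eq)) (s (suc N) / 1)) (∑-D N n n<N′))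
        (ℚ.+-identityˡ _)
    ... | inj₂ refl = trans
      (cong₂ _+_ (mono-refl (suc N) (s (suc N) / 1)) (∑-D-> {N} ℕ.≤-refl)) (ℚ.+-identityʳ _)

    -- Degree n + 1 of `θ-W`. As the logarithmic derivative has no constant term, the right side
    -- involves only degrees up to n; n < N ensures that its truncation at N is not felt there.
    W-rec : ∀ N n → n < N → + suc n / 1 * W N (suc n) ≡ ((λ i → s (suc i) / 1) ∗ W N) n
    W-rec N n n<N = begin
      + suc n / 1 * W N (suc n)
        ≡⟨ ×-ℚ (suc n) (W N (suc n)) ⟨
      θ (W N) (suc n)
        ≡⟨ θ-W N (suc n) ⟩
      (∑≤ N D ∗ W N) (suc n)
        ≡⟨ cong (λ x → x * W N (suc n) + (tail (∑≤ N D) ∗ W N) n) (∑-D-0 N) ⟩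
      0ℚ * W N (suc n) + (tail (∑≤ N D) ∗ W N) n
        ≡⟨ cong (_+ (tail (∑≤ N D) ∗ W N) n) (ℚ.*-zeroˡ (W N (suc n))) ⟩
      0ℚ + (tail (∑≤ N D) ∗ W N) n
        ≡⟨ ℚ.+-identityˡ _ ⟩
      (tail (∑≤ N D) ∗ W N) n
        ≡⟨ ∗-cong-≤ {g = W N} {W N} n (λ i i≤n → ∑-D N i (ℕ.≤-<-trans i≤n n<N)) (λ _ _ → refl) ⟩
      ((λ i → s (suc i) / 1) ∗ W N) n ∎

    module _ {t : Series} (t₀ : t 0 ≡ 1ℤ)
             (rec : ∀ n → + suc n ℤ.* t (suc n) ≡ ((λ i → s (suc i)) ⊛ t) n) where

      t-rec : ∀ n → + suc n / 1 * (t (suc n) / 1) ≡ ((λ i → s (suc i) / 1) ∗ (λ i → t i / 1)) n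
      t-rec n = begin
        + suc n / 1 * (t (suc n) / 1)               ≡⟨ /1-* (+ suc n) (t (suc n)) ⟨
        (+ suc n ℤ.* t (suc n)) / 1                 ≡⟨ cong (_/ 1) (rec n) ⟩
        ((λ i → s (suc i)) ⊛ t) n / 1               ≡⟨ /1-⊛ (λ i → s (suc i)) t n ⟩
        ((λ i → s (suc i) / 1) ∗ (λ i → t i / 1)) n ∎

      -- Both sequences start at 1 and obey the same recurrence, whose factor i + 1 cancels in ℚ.
      -- The claim covers all i ≤ n because the recurrence refers to every earlier term.
      t≡W : ∀ {N} n → n ≤ N → ∀ i → i ≤ n → t i / 1 ≡ W N i
      t≡W {N} n       n≤N zero    _         = trans (cong (_/ 1) t₀) (sym (W-0 N))
      t≡W {N} (suc n) n<N (suc i) (s≤s i≤n) = /1-cancelˡ (suc i) (t (suc i) / 1) (W N (suc i)) (begin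
        + suc i / 1 * (t (suc i) / 1)
          ≡⟨ t-rec i ⟩
        ((λ j → s (suc j) / 1) ∗ (λ j → t j / 1)) i
          ≡⟨ ∗-cong-≤ {λ j → s (suc j) / 1} {λ j → s (suc j) / 1} i (λ _ _ → refl)
               (λ j j≤i → t≡W n (ℕ.<⇒≤ n<N) j (ℕ.≤-trans j≤i i≤n)) ⟩
        ((λ j → s (suc j) / 1) ∗ W N) i
          ≡⟨ W-rec N i (ℕ.≤-<-trans i≤n n<N) ⟨
        + suc i / 1 * W N (suc i) ∎)

      t≡sumOverPartitions : ∀ n → t n / 1 ≡ sumOverPartitions n weight
      -- With `N` equal to n the bound on the parts admits every partition of n, and `W n n`
      -- computes to the full sum.
      t≡sumOverPartitions n = t≡W n ℕ.≤-refl n ℕ.≤-refl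

-- The recurrence n T_n = Σ S_k T_{n-k}

module TauRecurrence where

  open import Data.Integer.Base using (+_; -_; _*_; -1ℤ)
  open import Algebra.Properties.Semiring.Mult ℤ.+-*-semiring using (_×_)
  open import Relation.Binary.PropositionalEquality
    using (_≡_; refl; sym; trans; cong; cong₂; module ≡-Reasoning)
  open FormalSeries ℤ.+-*-commutativeSemiring

  ×-ℤ : ∀ n x → n × x ≡ + n * x
  ×-ℤ zero    x = sym (ℤ.*-zeroˡ x)
  ×-ℤ (suc n) x = trans (cong (λ y → x ℤ.+ y) (×-ℤ n x)) (sym (ℤ.suc-* (+ n) x))

  -- The logarithmic derivative of 1 − q^m.
  lambert : ℕ → Series
  lambert m zero    = 0ℤ
  lambert m (suc k) = if does (m ∣? suc k) then - (+ m) else 0ℤ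

  -- Periodicity holds only from positive degrees on: the value at 0 is 0, although every m divides
  -- 0.
  lambert-+ : ∀ m d → lambert (suc m) (suc m ℕ.+ suc d) ≡ lambert (suc m) (suc d)
  lambert-+ m d = cong (if_then - (+ suc m) else 0ℤ)
    (does-⇔ (mk⇔ (λ m∣ → ∣m+n∣m⇒∣n m∣ ∣-refl) (∣m∣n⇒∣m+n ∣-refl))
      (suc m ∣? (suc m ℕ.+ suc d)) (suc m ∣? suc d))

  lambert-< : ∀ m k → k < m → lambert m k ≡ 0ℤ
  lambert-< m zero    _   = refl
  lambert-< m (suc k) k<m = cong (if_then - (+ m) else 0ℤ)
    (dec-false (m ∣? suc k) λ m∣ → ℕ.<⇒≱ k<m (∣⇒≤ m∣))

  lambert-refl : ∀ m → lambert (suc m) (suc m) ≡ - (+ suc m)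
  lambert-refl m = cong (if_then - (+ suc m) else 0ℤ) (dec-true (suc m ∣? suc m) ∣-refl)

  -- In B - q^m B, with B the Lambert series, periodicity cancels every degree above m. Degree m
  -- keeps -m, because B has no constant term to cancel it, and this is the only coefficient of θ (1
  -- - q^m).
  θ-1-q^ : ∀ m → θ (𝟙 ⊖ q^ (suc m)) ≐ lambert (suc m) ∗ (𝟙 ⊖ q^ (suc m))
  θ-1-q^ m n = trans (×-ℤ n _) (trans (main n) (sym (∗-comm (lambert (suc m)) (𝟙 ⊖ q^ (suc m)) n)))
    where
    open ≡-Reasoning
    u = 𝟙 ⊖ q^ (suc m)
    B = lambert (suc m)

    binomial : u ≐ mono 0 1ℤ ⊞ mono (suc m) -1ℤ
    binomial n with n ℕ.≡ᵇ suc m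
    ... | true  = refl
    ... | false = refl

    expand : ∀ n → (u ∗ B) n ≡ B n ℤ.+ (mono (suc m) -1ℤ ∗ B) n
    expand n = begin
      (u ∗ B) n
        ≡⟨ ∗-cong {g = B} binomial (λ _ → refl) n ⟩
      ((mono 0 1ℤ ⊞ mono (suc m) -1ℤ) ∗ B) n
        ≡⟨ ∗-distribʳ B (mono 0 1ℤ) (mono (suc m) -1ℤ) n ⟩
      (mono 0 1ℤ ∗ B) n ℤ.+ (mono (suc m) -1ℤ ∗ B) n
        ≡⟨ cong (ℤ._+ (mono (suc m) -1ℤ ∗ B) n) (trans (mono-∗-+ 0 1ℤ B n) (ℤ.*-identityˡ (B n))) ⟩
      B n ℤ.+ (mono (suc m) -1ℤ ∗ B) n ∎

    low : ∀ n → n < suc m → + n * u n ≡ B n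
    low zero    _   = refl
    low (suc n) n<m = begin
      + suc n * (0ℤ ℤ.- q^ (suc m) (suc n))  ≡⟨ cong (λ x → + suc n * (0ℤ ℤ.- x)) (mono-≢ (ℕ.<⇒≢ n<m) 1ℤ) ⟩
      + suc n * 0ℤ                           ≡⟨ ℤ.*-zeroʳ (+ suc n) ⟩
      0ℤ                                     ≡⟨ lambert-< (suc m) (suc n) n<m ⟨
      B (suc n)                              ∎

    high : ∀ d → + (suc m ℕ.+ d) * u (suc m ℕ.+ d) ≡ B (suc m ℕ.+ d) ℤ.+ -1ℤ * B d
    high zero rewrite ℕ.+-identityʳ m = begin
      + suc m * (0ℤ ℤ.- q^ (suc m) (suc m))  ≡⟨ cong (λ x → + suc m * (0ℤ ℤ.- x)) (mono-refl (suc m) 1ℤ) ⟩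
      + suc m * -1ℤ                          ≡⟨ ℤ.*-comm (+ suc m) -1ℤ ⟩
      -1ℤ * + suc m                          ≡⟨ ℤ.-1*i≡-i (+ suc m) ⟩
      - (+ suc m)                            ≡⟨ ℤ.+-identityʳ _ ⟨
      - (+ suc m) ℤ.+ 0ℤ                     ≡⟨ cong (ℤ._+ 0ℤ) (lambert-refl m) ⟨
      B (suc m) ℤ.+ 0ℤ                       ∎
    high (suc d) = begin
      + n′ * (0ℤ ℤ.- q^ (suc m) n′)  ≡⟨ cong (λ x → + n′ * (0ℤ ℤ.- x)) (mono-≢ (ℕ.>⇒≢ (ℕ.m<m+n (suc m) (s≤s z≤n))) 1ℤ) ⟩
      + n′ * 0ℤ                      ≡⟨ ℤ.*-zeroʳ (+ n′) ⟩
      0ℤ                             ≡⟨ ℤ.+-inverseʳ (B (suc d)) ⟨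
      B (suc d) ℤ.+ - B (suc d)      ≡⟨ cong₂ ℤ._+_ (lambert-+ m d) (ℤ.-1*i≡-i (B (suc d))) ⟨
      B n′ ℤ.+ -1ℤ * B (suc d)       ∎
      where n′ = suc m ℕ.+ suc d

    main : ∀ n → + n * u n ≡ (u ∗ B) n
    main n with n ℕ.<? suc m
    ... | yes n<m = begin
      + n * u n                         ≡⟨ low n n<m ⟩
      B n                               ≡⟨ ℤ.+-identityʳ (B n) ⟨
      B n ℤ.+ 0ℤ                        ≡⟨ cong (λ x → B n ℤ.+ x) (mono-∗-< n<m -1ℤ B) ⟨
      B n ℤ.+ (mono (suc m) -1ℤ ∗ B) n  ≡⟨ expand n ⟨
      (u ∗ B) n                         ∎
    ... | no  n≮m with d , refl ← ℕ.m≤n⇒∃[o]m+o≡n (ℕ.≮⇒≥ n≮m) = begin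
      + n * u n                         ≡⟨ high d ⟩
      B n ℤ.+ -1ℤ * B d                 ≡⟨ cong (λ x → B n ℤ.+ x) (mono-∗-+ (suc m) -1ℤ B d) ⟨
      B n ℤ.+ (mono (suc m) -1ℤ ∗ B) n  ≡⟨ expand n ⟨
      (u ∗ B) n                         ∎

  θ-𝟙 : ∀ n → θ 𝟙 n ≡ 0ℤ
  θ-𝟙 zero    = refl
  θ-𝟙 (suc n) = trans (×-ℤ (suc n) 0ℤ) (ℤ.*-zeroʳ (+ suc n))

  θ-⊛^ : ∀ {b f} → θ f ≐ b ∗ f → ∀ e → θ (f ⊛^ e) ≐ (λ k → + e * b k) ∗ (f ⊛^ e)
  θ-⊛^ {b} {f} θf zero n = trans (θ-𝟙 n) (sym (∗-zeroˡ (λ k → ℤ.*-zeroˡ (b k)) 𝟙 n))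
  θ-⊛^ {b} {f} θf (suc e) n = trans
    (θ-log {b} {λ k → + e * b k} {f} {f ⊛^ e} θf (θ-⊛^ {b} {f} θf e) n)
    (∗-cong {g = f ⊛^ suc e} (λ k → sym (ℤ.suc-* (+ e) (b k))) (λ _ → refl) n)

  θ-∏≤ : ∀ {D F} → (∀ m → θ (F (suc m)) ≐ D (suc m) ∗ F (suc m)) →
         ∀ N → θ (∏≤ N F) ≐ ∑≤ N D ∗ ∏≤ N F
  θ-∏≤ {D} {F} θF zero    n = trans (θ-𝟙 n) (sym (∗-zeroˡ (λ _ → refl) 𝟙 n))
  θ-∏≤ {D} {F} θF (suc N) =
    θ-log {D (suc N)} {∑≤ N D} {F (suc N)} {∏≤ N F} (θF N) (θ-∏≤ θF N)

  -- σ with the range of candidate divisors detached from n, so that it can grow along with the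
  -- number of factors of the product.
  divisorSum : ℕ → ℕ → ℕ
  divisorSum N n = sum (filter (_∣? n) (applyUpTo suc N))

  divisorSum-suc : ∀ N n → divisorSum (suc N) n ≡ (if does (suc N ∣? n) then suc N else 0) ℕ.+ divisorSum N n
  divisorSum-suc N n = begin
    sum (filter (_∣? n) (applyUpTo suc (suc N)))
      ≡⟨ cong (λ xs → sum (filter (_∣? n) xs)) (applyUpTo-∷ʳ suc N) ⟨
    sum (filter (_∣? n) (applyUpTo suc N ++ [ suc N ]))
      ≡⟨ cong sum (filter-++ (_∣? n) (applyUpTo suc N) [ suc N ]) ⟩
    sum (filter (_∣? n) (applyUpTo suc N) ++ filter (_∣? n) [ suc N ])
      ≡⟨ sum-++ (filter (_∣? n) (applyUpTo suc N)) _ ⟩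
    divisorSum N n ℕ.+ sum (filter (_∣? n) [ suc N ])
      ≡⟨ cong (divisorSum N n ℕ.+_) last ⟩
    divisorSum N n ℕ.+ (if does (suc N ∣? n) then suc N else 0)
      ≡⟨ ℕ.+-comm (divisorSum N n) _ ⟩
    (if does (suc N ∣? n) then suc N else 0) ℕ.+ divisorSum N n ∎
    where
    open ≡-Reasoning
    last : sum (filter (_∣? n) [ suc N ]) ≡ (if does (suc N ∣? n) then suc N else 0)
    last with does (suc N ∣? n)
    ... | true  = ℕ.+-identityʳ (suc N)
    ... | false = refl

  divisorSum-≥ : ∀ n d → divisorSum (d ℕ.+ suc n) (suc n) ≡ σ (suc n)
  divisorSum-≥ n zero    = refl
  divisorSum-≥ n (suc d) = trans (divisorSum-suc (d ℕ.+ suc n) (suc n)) (trans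
    (cong (λ b → (if b then m else 0) ℕ.+ divisorSum (d ℕ.+ suc n) (suc n))
      (dec-false (m ∣? suc n) λ m∣n → ℕ.<⇒≱ (s≤s (ℕ.m≤n+m (suc n) d)) (∣⇒≤ m∣n)))
    (divisorSum-≥ n d))
    where m = suc (d ℕ.+ suc n)

  24lambert : ℕ → Series
  24lambert m k = + 24 * lambert m k

  ∑-lambert-0 : ∀ N → ∑≤ N 24lambert 0 ≡ 0ℤ
  ∑-lambert-0 zero    = refl
  ∑-lambert-0 (suc N) = trans (ℤ.+-identityˡ _) (∑-lambert-0 N)

  -- The m-th series contributes -24 m in degree n + 1 exactly when m divides n + 1.
  ∑-lambert : ∀ N n → ∑≤ N 24lambert (suc n) ≡ - (+ 24) * + divisorSum N (suc n)
  ∑-lambert zero    n = refl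
  ∑-lambert (suc N) n = begin
    + 24 * lambert (suc N) (suc n) ℤ.+ ∑≤ N 24lambert (suc n)
      ≡⟨ cong₂ ℤ._+_ term (∑-lambert N n) ⟩
    - (+ 24) * + t ℤ.+ - (+ 24) * + divisorSum N (suc n)
      ≡⟨ ℤ.*-distribˡ-+ (- (+ 24)) (+ t) (+ divisorSum N (suc n)) ⟨
    - (+ 24) * + (t ℕ.+ divisorSum N (suc n))
      ≡⟨ cong (λ x → - (+ 24) * + x) (divisorSum-suc N (suc n)) ⟨
    - (+ 24) * + divisorSum (suc N) (suc n) ∎
    where
    open ≡-Reasoning
    t = if does (suc N ∣? suc n) then suc N else 0
    term : + 24 * lambert (suc N) (suc n) ≡ - (+ 24) * + t
    term with does (suc N ∣? suc n)
    ... | true  = trans (sym (ℤ.neg-distribʳ-* (+ 24) (+ suc N))) (ℤ.neg-distribˡ-* (+ 24) (+ suc N))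
    ... | false = refl

  -- The index shift in `T` undoes the leading factor q in `τ`.
  T≡∏ : ∀ n → T n ≡ ∏≥1 eulerFactor n
  T≡∏ n = trans (cong τ (ℕ.+-comm n 1))
    (trans (mono-∗-+ 1 1ℤ (∏≥1 eulerFactor) n) (ℤ.*-identityˡ _))

  ∏-rec : ∀ {D F s} → (∀ m → F m ≡1below m) →
          (∀ m → θ (F (suc m)) ≐ D (suc m) ∗ F (suc m)) →
          (∀ N → ∑≤ N D 0 ≡ 0ℤ) →
          (∀ N i → i < N → ∑≤ N D (suc i) ≡ s i) →
          ∀ n → + suc n * ∏≥1 F (suc n) ≡ (s ∗ ∏≥1 F) n
  ∏-rec {D} {F} {s} F≡1 θF D₀ Dₛ n = begin
    -- In degree n + 1 the infinite product is `P` by definition; the lower degrees on the right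
    -- need `stable`.
    + suc n * P (suc n)
      ≡⟨ ×-ℤ (suc n) (P (suc n)) ⟨
    θ P (suc n)
      ≡⟨ θ-∏≤ {D} {F} θF (suc n) (suc n) ⟩
    (L ∗ P) (suc n)
      ≡⟨ cong (λ x → x * P (suc n) ℤ.+ (tail L ∗ P) n) (D₀ (suc n)) ⟩
    0ℤ * P (suc n) ℤ.+ (tail L ∗ P) n
      ≡⟨ ℤ.+-identityˡ _ ⟩
    (tail L ∗ P) n
      ≡⟨ ∗-cong-≤ n (λ i i≤n → Dₛ (suc n) i (s≤s i≤n)) stable ⟩
    (s ∗ ∏≥1 F) n ∎
    where
    open ≡-Reasoning
    P = ∏≤ (suc n) F
    L = ∑≤ (suc n) D
    stable : ∀ i → i ≤ n → P i ≡ ∏≥1 F i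
    stable i i≤n = trans
      (cong (λ N → ∏≤ N F i) (sym (ℕ.m∸n+n≡m (ℕ.m≤n⇒m≤1+n i≤n))))
      (∏≤-stable F≡1 i (suc n ∸ i))

  ∑-lambert-σ : ∀ N i → i < N → ∑≤ N 24lambert (suc i) ≡ S (suc i)
  ∑-lambert-σ N i i<N = trans (∑-lambert N i) (cong (λ x → - (+ 24) * + x)
    (trans (cong (λ N → divisorSum N (suc i)) (sym (ℕ.m∸n+n≡m i<N)))
      (divisorSum-≥ i (N ∸ suc i))))

  -- Only for a variable m is this equation cheap to check: at suc m the 24
  -- nested products start to unfold.
  eulerFactor-^ : ∀ m → eulerFactor m ≡ (𝟙 ⊖ q^ m) ⊛^ 24
  eulerFactor-^ m = refl

  θ-eulerFactor : ∀ m → θ (eulerFactor (suc m)) ≐ 24lambert (suc m) ∗ eulerFactor (suc m)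
  θ-eulerFactor m =
    power (𝟙 ⊖ q^ (suc m)) (lambert (suc m)) (24lambert (suc m)) (eulerFactor (suc m)) 24
      (eulerFactor-^ (suc m)) refl (θ-1-q^ m)
    where
    -- Stated for variables, so that no concrete power unfolds; 24 enters as an argument, the two
    -- series through equations.
    power : ∀ f b c g e → g ≡ f ⊛^ e → c ≡ (λ k → + e * b k) → θ f ≐ b ∗ f → θ g ≐ c ∗ g
    power f b _ _ e refl refl θf = θ-⊛^ {b} {f} θf e

  T-rec : ∀ n → + suc n * T (suc n) ≡ (tail S ∗ T) n
  T-rec = transport {T} {∏≥1 eulerFactor} {tail S} T≡∏
    (∏-rec {24lambert} {eulerFactor} {tail S} eulerFactor-≡1 θ-eulerFactor ∑-lambert-0 ∑-lambert-σ)
    where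
    transport : ∀ {t p s : Series} → t ≐ p → (∀ n → + suc n * p (suc n) ≡ (s ∗ p) n) →
                ∀ n → + suc n * t (suc n) ≡ (s ∗ t) n
    transport {t} {p} {s} t≐p rec n = trans (cong (+ suc n *_) (t≐p (suc n)))
      (trans (rec n) (∗-cong {s} {s} {p} {t} (λ _ → refl) (λ i → sym (t≐p i)) n))

-- Determinants of Hessenberg matrices

module Hessenberg where

  open import Data.Integer.Base using (+_; -_; _*_; -1ℤ; _^_)
  open import Data.Integer.Tactic.RingSolver using (solve-∀)
  open import Algebra.Properties.CommutativeMonoid.Sum ℤ.+-0-commutativeMonoid
    using (sum-cong-≗; sum-replicate-zero)
  open import Relation.Binary.PropositionalEquality
    using (_≡_; refl; sym; trans; cong; cong₂; module ≡-Reasoning)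
  open FormalSeries ℤ.+-*-commutativeSemiring

  -- The recursion lowers both indices at once, so deleting the first row and column gives a matrix
  -- of the same kind by computation, with `h` as its first column. A free first column `c` keeps
  -- the family closed under deleting the second column and under adding columns to the first.
  hessEntry : (c h b : Series) → ℕ → ℕ → ℤ
  hessEntry c h b i       zero          = c i
  hessEntry c h b zero    (suc zero)    = b 0
  hessEntry c h b zero    (suc (suc k)) = 0ℤ
  hessEntry c h b (suc i) (suc k)       = hessEntry h h (tail b) i k

  -- First column c, superdiagonal b, and Toeplitz columns h below it.
  hessenberg : ∀ n → (c h b : Series) → Matrix n
  hessenberg n c h b i k = hessEntry c h b (toℕ i) (toℕ k)

  det-cong : ∀ {n} {A B : Matrix n} → (∀ i k → A i k ≡ B i k) → det A ≡ det B
  det-cong {zero}  A≗B = refl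
  det-cong {suc n} A≗B = sum-cong-≗ {suc n} λ k →
    cong₂ _*_ (cong (-1ℤ ^ toℕ k *_) (A≗B zero k))
      (det-cong λ i j → A≗B (suc i) (punchIn k j))

  hessEntry-col : ∀ c c′ h b i k → hessEntry c h b i (suc k) ≡ hessEntry c′ h b i (suc k)
  hessEntry-col c c′ h b zero    zero    = refl
  hessEntry-col c c′ h b zero    (suc k) = refl
  hessEntry-col c c′ h b (suc i) k       = refl

  -- The first row has only the entries `c 0` and `b 0`. Deleting the second column keeps what
  -- remains of the first, hence `tail c` in the second minor.
  det-hessenberg-suc : ∀ n c h b →
    det (hessenberg (suc (suc n)) c h b) ≡
    c 0 * det (hessenberg (suc n) h h (tail b)) ℤ.- b 0 * det (hessenberg (suc n) (tail c) h (tail b))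
  det-hessenberg-suc n c h b = trans
    (cong₂ (λ x y → 1ℤ * c 0 * X ℤ.+ (-1ℤ * b 0 * x ℤ.+ y)) (det-cong minor) rest)
    (reshape (c 0) (b 0) X Y)
    where
    X = det (hessenberg (suc n) h h (tail b))
    Y = det (hessenberg (suc n) (tail c) h (tail b))
    A = hessenberg (suc (suc n)) c h b
    minor : ∀ i j → A (suc i) (punchIn (suc zero) j) ≡ hessenberg (suc n) (tail c) h (tail b) i j
    minor i zero    = refl
    minor i (suc j) = hessEntry-col h (tail c) h (tail b) (toℕ i) (toℕ j)
    cofactor : Fin n → ℤ
    cofactor k = det (λ i j → A (suc i) (punchIn (suc (suc k)) j))
    rest : sumℤ {n} (λ k → -1ℤ ^ toℕ (suc (suc k)) * 0ℤ * cofactor k) ≡ 0ℤ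
    rest = trans
      (sum-cong-≗ {n} λ k → trans (cong (_* cofactor k) (ℤ.*-zeroʳ (-1ℤ ^ toℕ (suc (suc k))))) (ℤ.*-zeroˡ (cofactor k)))
      (sum-replicate-zero n)
    reshape : ∀ c₀ b₀ x y → 1ℤ * c₀ * x ℤ.+ (-1ℤ * b₀ * y ℤ.+ 0ℤ) ≡ c₀ * x ℤ.- b₀ * y
    reshape = solve-∀

  det-hessenberg-1 : ∀ c h b → det (hessenberg 1 c h b) ≡ c 0
  det-hessenberg-1 c h b = solve (c 0)
    where
    solve : ∀ x → 1ℤ * x * 1ℤ ℤ.+ 0ℤ ≡ x
    solve = solve-∀

  -- Linearity in the first column is what justifies column operations; in the expansion the first
  -- minor does not depend on `c`, so induction treats the second.
  det-hessenberg-linear : ∀ n x c c′ h b →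
    det (hessenberg (suc n) (λ i → c i ℤ.+ x * c′ i) h b) ≡
    det (hessenberg (suc n) c h b) ℤ.+ x * det (hessenberg (suc n) c′ h b)
  det-hessenberg-linear zero x c c′ h b = trans
    (det-hessenberg-1 (λ i → c i ℤ.+ x * c′ i) h b)
    (sym (cong₂ (λ u v → u ℤ.+ x * v) (det-hessenberg-1 c h b) (det-hessenberg-1 c′ h b)))
  det-hessenberg-linear (suc n) x c c′ h b = begin
    det (hessenberg (suc (suc n)) (λ i → c i ℤ.+ x * c′ i) h b)
      ≡⟨ det-hessenberg-suc n (λ i → c i ℤ.+ x * c′ i) h b ⟩
    (c 0 ℤ.+ x * c′ 0) * X ℤ.- b 0 * det (hessenberg (suc n) (λ i → tail c i ℤ.+ x * tail c′ i) h (tail b))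
      ≡⟨ cong (λ y → (c 0 ℤ.+ x * c′ 0) * X ℤ.- b 0 * y) (det-hessenberg-linear n x (tail c) (tail c′) h (tail b)) ⟩
    (c 0 ℤ.+ x * c′ 0) * X ℤ.- b 0 * (Y ℤ.+ x * Y′)
      ≡⟨ reshape x (c 0) (c′ 0) (b 0) X Y Y′ ⟩
    (c 0 * X ℤ.- b 0 * Y) ℤ.+ x * (c′ 0 * X ℤ.- b 0 * Y′)
      ≡⟨ cong₂ (λ u v → u ℤ.+ x * v) (det-hessenberg-suc n c h b) (det-hessenberg-suc n c′ h b) ⟨
    det (hessenberg (suc (suc n)) c h b) ℤ.+ x * det (hessenberg (suc (suc n)) c′ h b) ∎
    where
    open ≡-Reasoning
    X  = det (hessenberg (suc n) h h (tail b))
    Y  = det (hessenberg (suc n) (tail c) h (tail b))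
    Y′ = det (hessenberg (suc n) (tail c′) h (tail b))
    reshape : ∀ x c₀ c₀′ b₀ X Y Y′ → (c₀ ℤ.+ x * c₀′) * X ℤ.- b₀ * (Y ℤ.+ x * Y′) ≡
              (c₀ * X ℤ.- b₀ * Y) ℤ.+ x * (c₀′ * X ℤ.- b₀ * Y′)
    reshape = solve-∀

  -- For size n + 1 the product also runs over `b n`, which lies outside the matrix; it comes from
  -- the bottom entry - x n * b n left by the elimination.
  ∏neg : ℕ → Series → ℤ
  ∏neg zero    b = 1ℤ
  ∏neg (suc n) b = - b 0 * ∏neg n (tail b)

  -- By the hypotheses, adding x k times column k + 2 to the first column, for all
  -- k, leaves a first column whose only non-zero entry is − x n * b n, at the bottom.
  det-hessenberg : ∀ n {c h b x} → c 0 ℤ.+ x 0 * b 0 ≡ 0ℤ →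
    (∀ i → c (suc i) ℤ.+ (x ∗ h) i ℤ.+ x (suc i) * b (suc i) ≡ 0ℤ) →
    det (hessenberg (suc n) c h b) ≡ x n * ∏neg (suc n) b
  det-hessenberg zero {c} {h} {b} {x} eq₀ eqs = begin
    det (hessenberg 1 c h b)                          ≡⟨ det-hessenberg-1 c h b ⟩
    c 0                                               ≡⟨ reshape (c 0) (x 0) (b 0) ⟩
    (c 0 ℤ.+ x 0 * b 0) ℤ.+ x 0 * (- b 0 * 1ℤ)        ≡⟨ cong (ℤ._+ x 0 * (- b 0 * 1ℤ)) eq₀ ⟩
    0ℤ ℤ.+ x 0 * (- b 0 * 1ℤ)                         ≡⟨ ℤ.+-identityˡ _ ⟩
    x 0 * (- b 0 * 1ℤ)                                ∎
    where
    open ≡-Reasoning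
    reshape : ∀ c x b → c ≡ (c ℤ.+ x * b) ℤ.+ x * (- b * 1ℤ)
    reshape = solve-∀
  det-hessenberg (suc n) {c} {h} {b} {x} eq₀ eqs = begin
    det (hessenberg (suc (suc n)) c h b)
      ≡⟨ det-hessenberg-suc n c h b ⟩
    c 0 * X ℤ.- b 0 * Y
      ≡⟨ reshape (c 0) (x 0) (b 0) X Y ⟩
    -- One column operation: x 0 times the second column clears the top entry, and by linearity the
    -- remaining minor has first column `tail c` plus x 0 times `h`.
    (c 0 ℤ.+ x 0 * b 0) * X ℤ.+ - b 0 * (Y ℤ.+ x 0 * X)
      ≡⟨ cong₂ (λ u v → u * X ℤ.+ - b 0 * v) eq₀ (sym (det-hessenberg-linear n (x 0) (tail c) h h (tail b))) ⟩
    0ℤ * X ℤ.+ - b 0 * det (hessenberg (suc n) c₁ h (tail b))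
      ≡⟨ cong (λ y → 0ℤ * X ℤ.+ - b 0 * y) (det-hessenberg n {c₁} {h} {tail b} {tail x} eq₀′ eqs′) ⟩
    0ℤ * X ℤ.+ - b 0 * (x (suc n) * ∏neg (suc n) (tail b))
      ≡⟨ reshape′ (b 0) X (x (suc n)) (∏neg (suc n) (tail b)) ⟩
    x (suc n) * ∏neg (suc (suc n)) b ∎
    where
    open ≡-Reasoning
    X = det (hessenberg (suc n) h h (tail b))
    Y = det (hessenberg (suc n) (tail c) h (tail b))
    c₁ : Series
    c₁ i = tail c i ℤ.+ x 0 * h i
    reshape : ∀ c x b X Y → c * X ℤ.- b * Y ≡ (c ℤ.+ x * b) * X ℤ.+ - b * (Y ℤ.+ x * X)
    reshape = solve-∀
    reshape′ : ∀ b X y p → 0ℤ * X ℤ.+ - b * (y * p) ≡ y * (- b * p)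
    reshape′ = solve-∀
    eq₀′ : c₁ 0 ℤ.+ x 1 * b 1 ≡ 0ℤ
    eq₀′ = trans (cong (λ y → c 1 ℤ.+ y ℤ.+ x 1 * b 1) (sym (ℤ.+-identityʳ (x 0 * h 0)))) (eqs 0)
    eqs′ : ∀ i → c₁ (suc i) ℤ.+ (tail x ∗ h) i ℤ.+ x (suc (suc i)) * b (suc (suc i)) ≡ 0ℤ
    eqs′ i = trans (cong (ℤ._+ x (suc (suc i)) * b (suc (suc i)))
      (ℤ.+-assoc (c (suc (suc i))) (x 0 * h (suc i)) ((tail x ∗ h) i))) (eqs (suc i))

  -- `J` and `H` as Hessenberg matrices

  hessEntry-toeplitz : ∀ h b i k →
    (if k <ᵇ suc i then h (i ∸ k) else if k ≡ᵇ suc i then b i else 0ℤ) ≡ hessEntry h h b i k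
  hessEntry-toeplitz h b i       zero          = refl
  hessEntry-toeplitz h b zero    (suc zero)    = refl
  hessEntry-toeplitz h b zero    (suc (suc k)) = refl
  hessEntry-toeplitz h b (suc i) (suc k)       = hessEntry-toeplitz h (tail b) i k

  det-J : ∀ n j → det (J (suc n) j) ≡ det (hessenberg (suc n) (tail j) (tail j) (λ i → - (+ suc i)))
  det-J n j = det-cong {suc n} {J (suc n) j} λ i k → entry (toℕ i) (toℕ k)
    where
    -- The tests on indices counted from 1 compute to these tests on indices counted from 0.
    entry : ∀ i k → (if k <ᵇ suc i then j (i ∸ k ℕ.+ 1) else if k ≡ᵇ i ℕ.+ 1 then - (+ suc i) else 0ℤ) ≡
      hessEntry (tail j) (tail j) (λ i → - (+ suc i)) i k
    entry i k rewrite ℕ.+-comm i 1 | ℕ.+-comm (i ∸ k) 1 =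
      hessEntry-toeplitz (tail j) (λ i → - (+ suc i)) i k

  det-H : ∀ n h → det (H (suc n) h) ≡
    det (hessenberg (suc n) (λ i → + suc i * h (suc i)) (tail h) (λ _ → 1ℤ))
  det-H n h = det-cong {suc n} {H (suc n) h} λ i k → entry (toℕ i) (toℕ k)
    where
    entry : ∀ i k → (if k ≡ᵇ 0 then + suc i * h (suc i) else
                     if k <ᵇ suc i then h (i ∸ k ℕ.+ 1) else if k ≡ᵇ i ℕ.+ 1 then 1ℤ else 0ℤ) ≡
      hessEntry (λ i → + suc i * h (suc i)) (tail h) (λ _ → 1ℤ) i k
    entry i zero = refl
    entry i (suc k) rewrite ℕ.+-comm i 1 | ℕ.+-comm (i ∸ suc k) 1 = trans
      -- Away from the first column `H` is Toeplitz, so `tail h` serves provisionally as first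
      -- column and is then exchanged for i h_i.
      (hessEntry-toeplitz (tail h) (λ _ → 1ℤ) i (suc k))
      (hessEntry-col (tail h) (λ i → + suc i * h (suc i)) (tail h) (λ _ → 1ℤ) i k)

  -- `∏neg` peels from the front while the factorial grows at the end.
  ∏neg-snoc : ∀ n b → ∏neg (suc n) b ≡ - b n * ∏neg n b
  ∏neg-snoc zero    b = refl
  ∏neg-snoc (suc n) b = trans (cong (- b 0 *_) (∏neg-snoc n (tail b)))
    (swap (- b 0) (- b (suc n)) (∏neg n (tail b)))
    where
    swap : ∀ x y z → x * (y * z) ≡ y * (x * z)
    swap = solve-∀

  ∏neg-factorial : ∀ n → ∏neg n (λ i → - (+ suc i)) ≡ + (n !)
  ∏neg-factorial zero    = refl
  ∏neg-factorial (suc n) = begin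
    ∏neg (suc n) (λ i → - (+ suc i))          ≡⟨ ∏neg-snoc n (λ i → - (+ suc i)) ⟩
    + suc n * ∏neg n (λ i → - (+ suc i))      ≡⟨ cong (+ suc n *_) (∏neg-factorial n) ⟩
    + suc n * + (n !)                       ≡⟨ ℤ.pos-* (suc n) (n !) ⟨
    + (suc n !)                             ∎
    where open ≡-Reasoning

  ∏neg-1 : ∀ n → ∏neg n (λ _ → 1ℤ) ≡ -1ℤ ^ n
  ∏neg-1 zero    = refl
  ∏neg-1 (suc n) = cong (-1ℤ *_) (∏neg-1 n)

  -1^n-square : ∀ n → -1ℤ ^ n * -1ℤ ^ n ≡ 1ℤ
  -1^n-square zero    = refl
  -1^n-square (suc n) = trans (reshape (-1ℤ ^ n)) (-1^n-square n)
    where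
    reshape : ∀ p → -1ℤ * p * (-1ℤ * p) ≡ p * p
    reshape = solve-∀

  -- Column relations supplied by the recurrence

  module _ {s t : Series} (t₀ : t 0 ≡ 1ℤ) (rec : ∀ n → + suc n * t (suc n) ≡ (tail s ∗ t) n) where

    open ≡-Reasoning

    private
      rec-0 : + 1 * t 1 ≡ s 1
      rec-0 = begin
        + 1 * t 1             ≡⟨ rec 0 ⟩
        s 1 * t 0 ℤ.+ 0ℤ      ≡⟨ ℤ.+-identityʳ _ ⟩
        s 1 * t 0             ≡⟨ cong (s 1 *_) t₀ ⟩
        s 1 * 1ℤ              ≡⟨ ℤ.*-identityʳ _ ⟩
        s 1                   ∎

      -- Since t 0 = 1, the last summand is s_{n+2} alone; what is left is a convolution of tails,
      -- as in the hypothesis of `det-hessenberg`.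
      rec-suc : ∀ n → + suc (suc n) * t (suc (suc n)) ≡ s (suc (suc n)) ℤ.+ (tail s ∗ tail t) n
      rec-suc n = begin
        + suc (suc n) * t (suc (suc n))                      ≡⟨ rec (suc n) ⟩
        (tail s ∗ t) (suc n)                                 ≡⟨ ∗-snoc (tail s) t n ⟩
        s (suc (suc n)) * t 0 ℤ.+ (tail s ∗ tail t) n        ≡⟨ cong (λ x → s (suc (suc n)) * x ℤ.+ (tail s ∗ tail t) n) t₀ ⟩
        s (suc (suc n)) * 1ℤ ℤ.+ (tail s ∗ tail t) n         ≡⟨ cong (ℤ._+ (tail s ∗ tail t) n) (ℤ.*-identityʳ (s (suc (suc n)))) ⟩
        s (suc (suc n)) ℤ.+ (tail s ∗ tail t) n              ∎

    n!t≡det-J : ∀ n → + (suc n !) * t (suc n) ≡ det (J (suc n) s)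
    n!t≡det-J n = sym (begin
      det (J (suc n) s)
        ≡⟨ det-J n s ⟩
      det (hessenberg (suc n) (tail s) (tail s) b)
        -- With coefficients t_1, t_2, ... row r of the combined column is s_r + Σ t_j s_{r-j} - r
        -- t_r, summed over 0 < j < r, which the recurrence makes 0.
        ≡⟨ det-hessenberg n {tail s} {tail s} {b} {tail t} eq₀ eqs ⟩
      t (suc n) * ∏neg (suc n) b
        ≡⟨ cong (t (suc n) *_) (∏neg-factorial (suc n)) ⟩
      t (suc n) * + (suc n !)
        ≡⟨ ℤ.*-comm (t (suc n)) (+ (suc n !)) ⟩
      + (suc n !) * t (suc n) ∎)
      where
      b : Series
      b i = - (+ suc i)
      eq₀ : s 1 ℤ.+ t 1 * b 0 ≡ 0ℤ
      eq₀ = trans (cong (ℤ._+ t 1 * b 0) (sym rec-0)) (cancel (t 1) (+ 1))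
        where
        cancel : ∀ x n → n * x ℤ.+ x * - n ≡ 0ℤ
        cancel = solve-∀
      eqs : ∀ i → s (suc (suc i)) ℤ.+ (tail t ∗ tail s) i ℤ.+ t (suc (suc i)) * b (suc i) ≡ 0ℤ
      eqs i = begin
        s (suc (suc i)) ℤ.+ (tail t ∗ tail s) i ℤ.+ t (suc (suc i)) * b (suc i)
          ≡⟨ cong (λ x → s (suc (suc i)) ℤ.+ x ℤ.+ t (suc (suc i)) * b (suc i)) (∗-comm (tail t) (tail s) i) ⟩
        s (suc (suc i)) ℤ.+ (tail s ∗ tail t) i ℤ.+ t (suc (suc i)) * b (suc i)
          ≡⟨ cong (ℤ._+ t (suc (suc i)) * b (suc i)) (rec-suc i) ⟨
        + suc (suc i) * t (suc (suc i)) ℤ.+ t (suc (suc i)) * b (suc i)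
          ≡⟨ cancel (t (suc (suc i))) (+ suc (suc i)) ⟩
        0ℤ ∎
        where
        cancel : ∀ x n → n * x ℤ.+ x * - n ≡ 0ℤ
        cancel = solve-∀

    s≡det-H : ∀ n → s (suc n) ≡ -1ℤ ^ n * det (H (suc n) t)
    s≡det-H n = sym (begin
      -1ℤ ^ n * det (H (suc n) t)
        ≡⟨ cong (-1ℤ ^ n *_) (det-H n t) ⟩
      -1ℤ ^ n * det (hessenberg (suc n) c (tail t) (λ _ → 1ℤ))
        -- Here the roles are exchanged: with coefficients -s_1, -s_2, ... row r is r t_r - Σ s_j
        -- t_{r-j} - s_r, again 0.
        ≡⟨ cong (-1ℤ ^ n *_) (det-hessenberg n {c} {tail t} {λ _ → 1ℤ} {x} eq₀ eqs) ⟩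
      -1ℤ ^ n * (-1ℤ * s (suc n) * ∏neg (suc n) (λ _ → 1ℤ))
        ≡⟨ cong (λ p → -1ℤ ^ n * (-1ℤ * s (suc n) * p)) (∏neg-1 (suc n)) ⟩
      -1ℤ ^ n * (-1ℤ * s (suc n) * (-1ℤ * -1ℤ ^ n))
        ≡⟨ reshape (s (suc n)) (-1ℤ ^ n) ⟩
      s (suc n) * (-1ℤ ^ n * -1ℤ ^ n)
        ≡⟨ cong (s (suc n) *_) (-1^n-square n) ⟩
      s (suc n) * 1ℤ
        ≡⟨ ℤ.*-identityʳ _ ⟩
      s (suc n) ∎)
      where
      c x : Series
      c i = + suc i * t (suc i)
      -- A multiple rather than a negation, so that `∗-scaleˡ` applies.
      x i = -1ℤ * s (suc i)
      reshape : ∀ y p → p * (-1ℤ * y * (-1ℤ * p)) ≡ y * (p * p)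
      reshape = solve-∀
      eq₀ : c 0 ℤ.+ x 0 * 1ℤ ≡ 0ℤ
      eq₀ = trans (cong (ℤ._+ x 0 * 1ℤ) rec-0) (cancel (s 1))
        where
        cancel : ∀ y → y ℤ.+ -1ℤ * y * 1ℤ ≡ 0ℤ
        cancel = solve-∀
      eqs : ∀ i → c (suc i) ℤ.+ (x ∗ tail t) i ℤ.+ x (suc i) * 1ℤ ≡ 0ℤ
      eqs i = begin
        c (suc i) ℤ.+ (x ∗ tail t) i ℤ.+ x (suc i) * 1ℤ
          ≡⟨ cong₂ (λ u v → u ℤ.+ v ℤ.+ x (suc i) * 1ℤ) (rec-suc i) (∗-scaleˡ -1ℤ (tail s) (tail t) i) ⟩
        s (suc (suc i)) ℤ.+ (tail s ∗ tail t) i ℤ.+ -1ℤ * (tail s ∗ tail t) i ℤ.+ -1ℤ * s (suc (suc i)) * 1ℤ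
          ≡⟨ cancel (s (suc (suc i))) ((tail s ∗ tail t) i) ⟩
        0ℤ ∎
        where
        cancel : ∀ y z → y ℤ.+ z ℤ.+ -1ℤ * z ℤ.+ -1ℤ * y * 1ℤ ≡ 0ℤ
        cancel = solve-∀

open import Data.Nat.Base using (ℕ; _≥_; _∸_; _!)
open import Data.Integer.Base using (+_; -_; _*_; -1ℤ; _^_)
open import Data.Rational.Base as ℚ using (_/_)
open import Data.Product.Base using (_×_)
open import Relation.Binary.PropositionalEquality using (_≡_)

open PartitionSum using (t≡sumOverPartitions)
open TauRecurrence using (T-rec)
open Hessenberg using (n!t≡det-J; s≡det-H)

theorem3p1 : ∀ n → n ≥ 1 →
    (+ (n !) * T n ≡ det (J n S)) ×
    (S n ≡ -1ℤ ^ (n ∸ 1) * det (H n T)) ×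
    (- (+ 24) * + σ n ≡ -1ℤ ^ (n ∸ 1) * det (H n T)) ×
    (T n / 1 ≡ sumOverPartitions n (λ ps → z⁻¹ ps ℚ.* ((S at ps) / 1)))
theorem3p1 (suc n) _ =
  n!t≡det-J {S} {T} T-0 T-rec n ,
  s≡det-H {S} {T} T-0 T-rec n ,
  -- `S` computes to -24 σ, so the proof of (ii) also serves for (iii).
  s≡det-H {S} {T} T-0 T-rec n ,
  t≡sumOverPartitions S {T} T-0 T-rec (suc n)
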